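{- Let $n\ge2$, $X=\mathbb{R}_+^n$ (the non-negative orthant), $\mathcal{A}\subset\mathbb{R}^n$ a non-empty finite set, and $\beta\in\mathcal{A}$. A normalized element $\lambda\in N_\beta$ (i.e. $\lambda_\beta=-1$) with $|\lambda^+|\ge2$ is contained in $\Lambda_X(\mathcal{A},\beta)$ if and only if there exists a non-empty subset $S\subset[n]$ with $|\{\alpha_S : \alpha\in\operatorname{supp}\lambda\}|=|\operatorname{supp}\lambda|$ such that $\lambda$ is an $\mathbb{R}^{|S|}$-circuit for the support set $\mathcal{A}_S$ and $(\mathcal{A}\lambda)_{[n]\setminus S}>\mathbf{0}$.
   Context: $[n]=\{1,\ldots,n\}$. $\mathbb{R}^{\mathcal{A}}$ is the set of real vectors indexed by $\mathcal{A}$. For $\beta\in\mathcal{A}$, $N_\beta=\{\nu\in\mathbb{R}^{\mathcal{A}} : \nu_\alpha\ge 0 \text{ for all }\alpha\in\mathcal{A}\setminus\{\beta\},\ \sum_{\alpha\in\mathcal{A}}\nu_\alpha=0\}$. For $\nu\in\mathbb{R}^{\mathcal{A}}$ write $\mathcal{A}\nu=\sum_{\alpha\in\mathcal{A}}\alpha\,\nu_\alpha\in\mathbb{R}^n$. For a non-empty convex set $X\subset\mathbb{R}^n$, $\sigma_X(y)=\sup\{y^Tx : x\in X\}$ is the support function. A non-zero vector $\nu^*\in N_\beta$ is an $X$-circuit for the support set $\mathcal{A}$ (sublinear circuit of $\mathcal{A}$ with respect to $X$) if (i) $\sigma_X(-\mathcal{A}\nu^*)<\infty$, and (ii) whenever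 the map $\nu\mapsto\sigma_X(-\mathcal{A}\nu)$ is linear on a two-dimensional convex cone contained in $N_\beta$ (i.e. is finite there and coincides there with a linear function), $\nu^*$ is not in the relative interior of that cone. The same definition applies to any dimension, finite support set and convex set. $\Lambda_X(\mathcal{A},\beta)$ denotes the set of $X$-circuits $\lambda\in N_\beta$ with $\lambda_\beta=-1$. $\operatorname{supp}\lambda=\{\alpha\in\mathcal{A}:\lambda_\alpha\neq0\}$ and $\lambda^+=\{\alpha\in\mathcal{A}:\lambda_\alpha>0\}$. For $S\subset[n]$ and $v\in\mathbb{R}^n$, $v_S=(v_s)_{s\in S}$, and $\mathcal{A}_S=\{\alpha_S:\alpha\in\mathcal{A}\}$. The inequality $v>\mathbf{0}$ for vectors is componentwise strict (and holds vacuously for vectors with no components). When $\alpha\mapsto\alpha_S$ is injective on $\operatorname{supp}\lambda$, $\lambda$ is regarded as the vector in $\mathbb{R}^{\mathcal{A}_S}$ whose entry at $\alpha_S$ is $\lambda_\alpha$ for $\alpha\in\operatorname{supp}\lambda$ and whose other entries are $0$; "$\lambda$ is an $\mathbb{R}^{|S|}$-circuit for $\mathcal{A}_S$" refers to this vector. -}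

module Defs where

open import Algebra.Bundles using (CommutativeRing)
open import Data.Fin.Base using (Fin)
open import Data.Fin.Properties using (any?)
open import Data.Fin.Subset using (Subset; inside; outside; ∣_∣)
open import Data.List.Base as List using (List; length; deduplicate; filter; allFin)
import Data.List.Membership.Setoid as Membership
import Data.List.Relation.Unary.Any as Any
import Data.List.Relation.Unary.Unique.DecSetoid.Properties as Unique
import Data.List.Relation.Unary.Unique.Setoid as Unique
open import Data.Nat.Base as ℕ using (ℕ)
open import Data.Product using (∃; ∃-syntax; _×_; _,_; proj₁)
open import Data.Vec.Base using ([]; _∷_)
import Data.Vec.Functional as Vector
import Data.Vec.Functional.Relation.Binary.Equality.Setoid as VecEq
import Data.Vec.Functional.Relation.Binary.Pointwise.Properties as Pointwise
open import Level using (Level; suc; _⊔_)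
open import Relation.Binary.Bundles using (DecSetoid)
open import Relation.Binary.Core using (Rel; _Preserves_⟶_)
open import Relation.Binary.Definitions using (_Respects_)
open import Relation.Binary.Structures using (IsDecTotalOrder)
open import Relation.Nullary using (¬_; Dec; yes; no)
open import Relation.Nullary.Decidable using (¬?; _×-dec_)
open import Relation.Unary using (Pred; _⊆_)

-- The real numbers, given axiomatically as a Dedekind-complete ordered field;
-- classically this determines them up to isomorphism.  As in classical
-- analysis, the order is decidable.
record Reals c ℓ₁ ℓ₂ : Set (suc (c ⊔ ℓ₁ ⊔ ℓ₂)) where
  infix 4 _≤_ _<_
  field
    commutativeRing : CommutativeRing c ℓ₁

  open CommutativeRing commutativeRing public renaming (Carrier to ℝ)

  field
    _≤_             : Rel ℝ ℓ₂
    isDecTotalOrder : IsDecTotalOrder _≈_ _≤_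
    0≉1             : ¬ (0# ≈ 1#)
    inverse         : ∀ x → ¬ (x ≈ 0#) → ∃[ y ] x * y ≈ 1#
    +-monoˡ-≤       : ∀ z {x y} → x ≤ y → x + z ≤ y + z
    *-nonNeg        : ∀ {x y} → 0# ≤ x → 0# ≤ y → 0# ≤ x * y

  open IsDecTotalOrder isDecTotalOrder public using (_≟_; _≤?_)

  _<_ : Rel ℝ (ℓ₁ ⊔ ℓ₂)
  x < y = x ≤ y × ¬ (x ≈ y)

  _<?_ : ∀ x y → Dec (x < y)
  x <? y = (x ≤? y) ×-dec ¬? (x ≟ y)

  IsUpperBound : ∀ {i} {I : Set i} → (I → ℝ) → ℝ → Set (i ⊔ ℓ₂)
  IsUpperBound f u = ∀ i → f i ≤ u

  IsSupremum : ∀ {i} {I : Set i} → (I → ℝ) → ℝ → Set (i ⊔ c ⊔ ℓ₂)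
  IsSupremum f s = IsUpperBound f s × (∀ u → IsUpperBound f u → s ≤ u)

  field
    complete : ∀ {I : Set (c ⊔ ℓ₁ ⊔ ℓ₂)} (f : I → ℝ) →
               I → ∃ (IsUpperBound f) → ∃ (IsSupremum f)

  decSetoid : DecSetoid c ℓ₁
  decSetoid = record
    { isDecEquivalence = record { isEquivalence = isEquivalence ; _≟_ = _≟_ } }

module Circuits {c ℓ₁ ℓ₂ : Level} (R : Reals c ℓ₁ ℓ₂) where
  open Reals R
  open import Algebra.Properties.Monoid.Sum +-monoid public using (sum)
  open VecEq setoid public using (_≋_; ≋-setoid)

  private
    variable
      k n : ℕ
      p : Level

  ℝ^_ : ℕ → Set c
  ℝ^ n = Vector.Vector ℝ n

  ≋-decSetoid : ℕ → DecSetoid c ℓ₁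
  ≋-decSetoid = Pointwise.decSetoid decSetoid

  _≋?_ : (x y : ℝ^ n) → Dec (x ≋ y)
  _≋?_ {n} = DecSetoid._≟_ (≋-decSetoid n)

  infixl 6 _⊕_
  infixr 7 _⊙_

  _⊕_ : ℝ^ n → ℝ^ n → ℝ^ n
  (x ⊕ y) i = x i + y i

  _⊙_ : ℝ → ℝ^ n → ℝ^ n
  (t ⊙ x) i = t * x i

  ⊖_ : ℝ^ n → ℝ^ n
  (⊖ x) i = - x i

  𝟎 : ℝ^ n
  𝟎 _ = 0#

  _·_ : ℝ^ n → ℝ^ n → ℝ
  x · y = sum (λ i → x i * y i)

  combination : (Fin k → ℝ^ n) → ℝ^ k → ℝ^ n
  combination v w j = sum (λ i → v i j * w i)

  record IsLinear (f : ℝ^ n → ℝ) : Set (c ⊔ ℓ₁) where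
    field
      cong   : f Preserves _≋_ ⟶ _≈_
      ⊕-homo : ∀ x y → f (x ⊕ y) ≈ f x + f y
      ⊙-homo : ∀ t x → f (t ⊙ x) ≈ t * f x

  AffineHull : Pred (ℝ^ n) p → Pred (ℝ^ n) (c ⊔ ℓ₁ ⊔ p)
  AffineHull C x = ∃[ k ] ∃[ v ] ∃[ w ]
    (∀ (i : Fin k) → C (v i)) × sum w ≈ 1# × x ≋ combination v w

  AffinelyIndependent : (Fin k → ℝ^ n) → Set (c ⊔ ℓ₁)
  AffinelyIndependent v = ∀ w → sum w ≈ 0# → combination v w ≋ 𝟎 → w ≋ 𝟎

  -- The dimension of a convex set is that of its affine hull: some d + 1
  -- affinely independent points of the set affinely span it.
  HasDimension : Pred (ℝ^ n) p → ℕ → Set (c ⊔ ℓ₁ ⊔ p)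
  HasDimension {n} C d = ∃[ v ]
    (∀ (i : Fin (ℕ.suc d)) → C (v i)) × AffinelyIndependent v ×
    (∀ {x : ℝ^ n} → C x → ∃[ w ] sum w ≈ 1# × x ≋ combination v w)

  -- Neighbourhoods are open boxes; they give the usual topology of ℝ^ n.
  RelativeInterior : Pred (ℝ^ n) p → Pred (ℝ^ n) (c ⊔ ℓ₁ ⊔ ℓ₂ ⊔ p)
  RelativeInterior C x = C x × ∃[ ε ] 0# < ε ×
    (∀ y → AffineHull C y → (∀ i → x i - ε < y i × y i < x i + ε) → C y)

  -- The origin need not belong to the cone.
  record IsConvexCone (C : Pred (ℝ^ n) p) : Set (c ⊔ ℓ₁ ⊔ ℓ₂ ⊔ p) where
    field
      respects : C Respects _≋_
      closed   : ∀ {s t x y} → 0# < s → 0# < t → C x → C y → C (s ⊙ x ⊕ t ⊙ y)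

  -- σ X y s says that s is the (finite) value at y of the support function of
  -- X, so for non-empty X the value is finite exactly when such an s exists.
  σ : Pred (ℝ^ n) p → ℝ^ n → ℝ → Set (c ⊔ ℓ₂ ⊔ p)
  σ X y = IsSupremum {I = ∃ X} (λ x → y · proj₁ x)

  Orthant : Pred (ℝ^ n) ℓ₂
  Orthant x = ∀ i → 0# ≤ x i

  record SupportSet (n : ℕ) : Set (c ⊔ ℓ₁) where
    field
      points   : List (ℝ^ n)
      distinct : Unique.Unique (≋-setoid n) points

  open SupportSet public

  card : SupportSet n → ℕ
  card A = length (points A)

  infix 9 _[_]

  _[_] : (A : SupportSet n) → Fin (card A) → ℝ^ n
  A [ i ] = List.lookup (points A) i

  _∈ˢ_ : ℝ^ n → SupportSet n → Set (c ⊔ ℓ₁)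
  _∈ˢ_ {n} α A = Membership._∈_ (≋-setoid n) α (points A)

  -- A vector indexed by A is indexed by the positions in the list of points.
  ℝ^ˢ_ : SupportSet n → Set c
  ℝ^ˢ A = ℝ^ card A

  coord : (A : SupportSet n) {α : ℝ^ n} → ℝ^ˢ A → α ∈ˢ A → ℝ
  coord A ν α∈A = ν (Any.index α∈A)

  _∙_ : (A : SupportSet n) → ℝ^ˢ A → ℝ^ n
  A ∙ ν = combination (A [_]) ν

  N : (A : SupportSet n) → ℝ^ n → Pred (ℝ^ˢ A) (ℓ₁ ⊔ ℓ₂)
  N A β ν = (∀ i → ¬ (A [ i ] ≋ β) → 0# ≤ ν i) × sum ν ≈ 0#

  LinearOn : Pred (ℝ^ n) p → (A : SupportSet n) →
             Pred (ℝ^ˢ A) (c ⊔ ℓ₁ ⊔ ℓ₂) → Set (c ⊔ ℓ₁ ⊔ ℓ₂ ⊔ p)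
  LinearOn X A C =
    ∃[ f ] IsLinear f × (∀ {ν} → C ν → σ X (⊖ (A ∙ ν)) (f ν))

  record IsCircuit (X : Pred (ℝ^ n) p) (A : SupportSet n) (β : ℝ^ n)
                   (ν : ℝ^ˢ A) : Set (suc (c ⊔ ℓ₁ ⊔ ℓ₂) ⊔ p) where
    field
      ν∈N      : N A β ν
      nonZero  : ¬ (ν ≋ 𝟎)
      finite   : ∃ (σ X (⊖ (A ∙ ν)))
      extremal : ∀ (C : Pred (ℝ^ˢ A) (c ⊔ ℓ₁ ⊔ ℓ₂)) →
                 IsConvexCone C → HasDimension C 2 → C ⊆ N A β →
                 LinearOn X A C → ¬ RelativeInterior C ν

  Λ : (X : Pred (ℝ^ n) p) (A : SupportSet n) {β : ℝ^ n} → β ∈ˢ A →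
      Pred (ℝ^ˢ A) (ℓ₁ ⊔ suc (c ⊔ ℓ₁ ⊔ ℓ₂) ⊔ p)
  Λ X A {β} β∈A ν = IsCircuit X A β ν × coord A ν β∈A ≈ - 1#

  supp : (A : SupportSet n) → ℝ^ˢ A → List (Fin (card A))
  supp A ν = filter (λ i → ¬? (ν i ≟ 0#)) (allFin (card A))

  supp⁺ : (A : SupportSet n) → ℝ^ˢ A → List (Fin (card A))
  supp⁺ A ν = filter (λ i → 0# <? ν i) (allFin (card A))

  restrict : (S : Subset n) → ℝ^ n → ℝ^ ∣ S ∣
  restrict []            x = x
  restrict (inside  ∷ S) x = Vector.head x Vector.∷ restrict S (Vector.tail x)
  restrict (outside ∷ S) x = restrict S (Vector.tail x)

  -- Points of A with the same restriction to S give a single point.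
  project : (S : Subset n) → SupportSet n → SupportSet ∣ S ∣
  project S A = record
    { points   = deduplicate _≋?_ (List.map (restrict S) (points A))
    ; distinct = Unique.deduplicate-! (≋-decSetoid ∣ S ∣)
                   (List.map (restrict S) (points A))
    }

  -- The set { α restricted to S | α ∈ supp ν }, listed without repetition.
  projectedSupp : (S : Subset n) (A : SupportSet n) → ℝ^ˢ A → List (ℝ^ ∣ S ∣)
  projectedSupp S A ν =
    deduplicate _≋?_ (List.map (λ i → restrict S (A [ i ])) (supp A ν))

  -- When restriction to S is injective on supp ν, the choice made by any? is
  -- unique.
  transport : (S : Subset n) (A : SupportSet n) → ℝ^ˢ A → ℝ^ˢ (project S A)
  transport S A ν j
    with any? (λ i → ¬? (ν i ≟ 0#) ×-dec
                     (restrict S (A [ i ]) ≋? (project S A [ j ])))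
  ... | yes (i , _) = ν i
  ... | no _        = 0#

-- Let X be the orthant or the whole space.  Then σ_X(-Aν) is finite exactly
-- when every coordinate of Aν is ≥ 0, respectively = 0, and it vanishes there.
-- Hence the X-circuits ν with ν_β = -1 are the extreme rays of the cone K of all
-- ν ∈ N_β with finite σ_X(-Aν), and ν ∈ K is extreme if and only if every
-- direction μ along which no active constraint changes (μ is supported on
-- supp ν, ∑ μ = 0, and (Aμ)_j = 0 wherever (Aν)_j = 0) is a multiple of ν.
-- This criterion is the same for both X, and it transfers along the pushforward
-- of vectors from A to A_S when S = { j | (Aν)_j = 0 } and α ↦ α_S is injective
-- on supp ν.  For a circuit of the orthant the injectivity is automatic: if
-- α_S = α′_S, then e_α - e_α′ is such a direction, but supp ν has at least three
-- elements.
module Submission where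

open import Defs
open import Algebra.Bundles using (RawRing)
import Algebra.Properties.AbelianGroup as AbelianGroupProperties
import Algebra.Properties.Ring as RingProperties
import Algebra.Properties.Semiring.Mult.TCOptimised as Multiples
import Algebra.Properties.Semiring.Sum as Summation
import Algebra.Solver.Ring as RingSolver
open import Algebra.Solver.Ring.AlmostCommutativeRing
  using (_-Raw-AlmostCommutative⟶_; Induced-equivalence; fromCommutativeRing)
open import Data.Empty using (⊥)
open import Data.Fin.Base using (Fin; zero; suc)
open import Data.Fin.Properties as Fin using (any?)
open import Data.Fin.Subset using (Subset; inside; outside; ∣_∣; _∈_; _∉_; Nonempty)
open import Data.Fin.Subset.Properties using (nonempty?; _∈?_)
open import Data.List.Base
  using (List; []; _∷_; length; map; lookup; filter; deduplicate; allFin)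
open import Data.List.Properties
  using (filter-all; filter-complete; length-filter; length-map; length-deduplicate)
import Data.List.Membership.Propositional as Propositional
import Data.List.Membership.Propositional.Properties as Propositional
import Data.List.Membership.Setoid.Properties as Membership
open import Data.List.Relation.Unary.All as All using (_∷_)
open import Data.List.Relation.Unary.AllPairs using (AllPairs; []; _∷_)
import Data.List.Relation.Unary.AllPairs.Properties as AllPairs
open import Data.List.Relation.Unary.Any as Any using (here; there)
import Data.List.Relation.Unary.Any.Properties as Any
import Data.List.Relation.Unary.Unique.DecSetoid.Properties as Unique
import Data.List.Relation.Unary.Unique.Propositional as Propositional
import Data.List.Relation.Unary.Unique.Propositional.Properties as Unique
open import Data.List.Relation.Unary.Unique.Setoid using (Unique)
import Data.Maybe.Base as Maybe
open import Data.Nat.Base as ℕ using (ℕ)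
import Data.Nat.Properties as ℕ
open import Data.Product using (∃-syntax; _×_; _,_; proj₁; proj₂)
open import Data.Product.Properties using (≡-dec)
open import Data.Sum.Base using (_⊎_; inj₁; inj₂)
open import Data.Vec.Base as Vec using ([]; _∷_; here; there)
import Data.Vec.Functional as Vector
open import Data.Vec.Properties using ([]=⇒lookup; lookup⇒[]=; lookup∘tabulate)
open import Function.Base using (_∘_)
open import Function.Bundles using (_⇔_; mk⇔)
open import Level using (0ℓ; _⊔_)
open import Relation.Binary.Bundles using (Setoid; DecSetoid)
open import Relation.Binary.Definitions using (WeaklyDecidable)
open import Relation.Binary.PropositionalEquality as ≡ using (_≡_; _≢_)
import Relation.Binary.Reasoning.Setoid as SetoidReasoning
open import Relation.Binary.Structures using (IsDecTotalOrder)
open import Relation.Nullary using (¬_; Dec; yes; no; contradiction)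
open import Relation.Nullary.Decidable
  using (¬?; _×-dec_; decidable-stable; dec⇒maybe; does; dec-true; dec-false)
open import Relation.Unary using (Pred; _⊆_; U)

-- The definition of a circuit tests arbitrary two-dimensional cones through their relative
-- interiors, and this has to be matched with extremality in K. If ν is interior to such a cone C
-- inside K, small steps from ν of either sign along differences of points of C stay in K. These
-- differences are then flat, and extremality would put three affinely independent points of C on
-- one line. Conversely, a flat direction that is not a multiple of ν can be changed by a multiple
-- of ν until it vanishes at β; the feasible vectors in the plane it spans with ν then form a
-- two-dimensional cone around ν. The normalization ν_β = -1 enters both ways. The entry at β is the
-- only one whose sign is free, and being non-zero it never imposes anything on a flat direction;
-- and a non-zero direction vanishing at β is independent of ν. In the implication from S to the
-- orthant, S is given rather than chosen, but a circuit of the whole space forces Aν to vanish on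
-- S, so that positivity elsewhere makes S the zero set after all.

-- Lists without repetition

Unique⇒lookup-injective : ∀ {a ℓ} (S : Setoid a ℓ) {xs} → Unique S xs →
  ∀ i j → Setoid._≈_ S (lookup xs i) (lookup xs j) → i ≡ j
Unique⇒lookup-injective S (_ ∷ _)   zero    zero    _ = ≡.refl
Unique⇒lookup-injective S (x∉ ∷ _)  zero    (suc j) e = contradiction e
  (All.lookup x∉ (Propositional.∈-lookup j))
Unique⇒lookup-injective S (x∉ ∷ _)  (suc i) zero    e =
  contradiction (Setoid.sym S e) (All.lookup x∉ (Propositional.∈-lookup i))
Unique⇒lookup-injective S (_ ∷ xs!) (suc i) (suc j) e =
  ≡.cong suc (Unique⇒lookup-injective S xs! i j e)

AllPairs⇒≡⊎ : ∀ {a r} {A : Set a} {R : A → A → Set r} → (∀ {x y} → R x y → R y x) →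
  ∀ {xs} → AllPairs R xs → ∀ {x y} → x Propositional.∈ xs → y Propositional.∈ xs → x ≡ y ⊎ R x y
AllPairs⇒≡⊎ R-sym (_  ∷ _)  (here ≡.refl) (here ≡.refl) = inj₁ ≡.refl
AllPairs⇒≡⊎ R-sym (px ∷ _)  (here ≡.refl) (there y∈)    = inj₂ (All.lookup px y∈)
AllPairs⇒≡⊎ R-sym (px ∷ _)  (there x∈)    (here ≡.refl) = inj₂ (R-sym (All.lookup px x∈))
AllPairs⇒≡⊎ R-sym (_  ∷ ps) (there x∈)    (there y∈)    = AllPairs⇒≡⊎ R-sym ps x∈ y∈

module _ {a ℓ} (DS : DecSetoid a ℓ) where
  open DecSetoid DS using (_≈_; _≟_; setoid)

  deduplicate-complete : ∀ xs → length (deduplicate _≟_ xs) ≡ length xs →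
                         deduplicate _≟_ xs ≡ xs
  deduplicate-complete []       _ = ≡.refl
  deduplicate-complete (x ∷ xs) e = ≡.cong (x ∷_) (≡.trans
    (filter-complete (¬? ∘ (x ≟_)) (≡.trans e′ (≡.sym same)))
    (deduplicate-complete xs same))
    where
    e′ = ℕ.suc-injective e
    same : length (deduplicate _≟_ xs) ≡ length xs
    -- Deduplicating and then filtering can only shorten, but by `e′` the final length is again that
    -- of `xs`; so neither operation removes anything.
    same = ℕ.≤-antisym (length-deduplicate _≟_ xs)
      (ℕ.≤-trans (ℕ.≤-reflexive (≡.sym e′)) (length-filter (¬? ∘ (x ≟_)) (deduplicate _≟_ xs)))

  Unique⇒deduplicate≡ : ∀ {xs} → Unique setoid xs → deduplicate _≟_ xs ≡ xs
  Unique⇒deduplicate≡ []         = ≡.refl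
  Unique⇒deduplicate≡ {x ∷ xs} (x∉ ∷ xs!) = ≡.cong (x ∷_) (≡.trans
    (≡.cong (filter (¬? ∘ (x ≟_))) (Unique⇒deduplicate≡ xs!))
    (filter-all (¬? ∘ (x ≟_)) x∉))

  module _ {b} {B : Set b} (f : B → DecSetoid.Carrier DS) {xs : List B} where

    -- This and its converse below turn the cardinality condition on the projected support into
    -- injectivity of the projection.
    deduplicate-map⇒injective : length (deduplicate _≟_ (map f xs)) ≡ length xs →
      ∀ {x y} → x Propositional.∈ xs → y Propositional.∈ xs → f x ≈ f y → x ≡ y
    deduplicate-map⇒injective same {x} {y} x∈ y∈ fx≈fy
      with AllPairs⇒≡⊎ {R = λ x y → ¬ f x ≈ f y} (_∘ DecSetoid.sym DS) distinct x∈ y∈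
      where
      distinct : AllPairs (λ x y → ¬ f x ≈ f y) xs
      distinct = AllPairs.map⁻ (≡.subst (Unique setoid)
        (deduplicate-complete (map f xs) (≡.trans same (≡.sym (length-map f xs))))
        (Unique.deduplicate-! DS (map f xs)))
    ... | inj₁ x≡y   = x≡y
    ... | inj₂ fx≉fy = contradiction fx≈fy fx≉fy

    injective⇒deduplicate-map : Propositional.Unique xs →
      (∀ {x y} → x Propositional.∈ xs → y Propositional.∈ xs → f x ≈ f y → x ≡ y) →
      length (deduplicate _≟_ (map f xs)) ≡ length xs
    injective⇒deduplicate-map xs! injective = ≡.trans
      (≡.cong length (Unique⇒deduplicate≡ (AllPairs.map⁺ (distinct xs! injective))))
      (length-map f xs)
      where
      distinct : ∀ {xs} → Propositional.Unique xs →
        (∀ {x y} → x Propositional.∈ xs → y Propositional.∈ xs → f x ≈ f y → x ≡ y) →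
        AllPairs (λ x y → ¬ f x ≈ f y) xs
      distinct []         injective = []
      distinct (x∉ ∷ xs!) injective =
        All.tabulate (λ y∈ fx≈fy →
          All.lookup x∉ y∈ (injective (here ≡.refl) (there y∈) fx≈fy)) ∷
        distinct xs! (λ x∈ y∈ → injective (there x∈) (there y∈))

module _ {c ℓ₁ ℓ₂} (R : Reals c ℓ₁ ℓ₂) where

  open Reals R hiding (zero)
  open Circuits R
  open IsDecTotalOrder isDecTotalOrder
    using (total; antisym; ≤-respˡ-≈; ≤-respʳ-≈)
    renaming (refl to ≤-refl; trans to ≤-trans; reflexive to ≤-reflexive)
  open RingProperties ring using (-‿distribˡ-*; -‿distribʳ-*; -‿involutive; -0#≈0#)
  open AbelianGroupProperties +-abelianGroup using (⁻¹-∙-comm)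
  open Multiples semiring using (×-homo-+; ×1-homo-*) renaming (_×_ to _•_)
  open Summation semiring
    using (sum-cong-≋; ∑-distrib-+; ∑-comm; *-distribˡ-sum; sum-replicate-zero)

  -- Ordered fields

  -- The ring solver needs coefficients with a computing equality test: the
  -- integers, as formal differences of naturals, one of which is zero.
  private
    cancel : ℕ → ℕ → ℕ × ℕ
    cancel (ℕ.suc a) (ℕ.suc b) = cancel a b
    cancel a         b         = a , b

    differences : RawRing 0ℓ 0ℓ
    differences = record
      { Carrier = ℕ × ℕ
      ; _≈_     = _≡_
      ; _+_     = λ (a , b) (a′ , b′) → cancel (a ℕ.+ a′) (b ℕ.+ b′)
      ; _*_     = λ (a , b) (a′ , b′) →
                    cancel (a ℕ.* a′ ℕ.+ b ℕ.* b′) (a ℕ.* b′ ℕ.+ b ℕ.* a′)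
      ; -_      = λ (a , b) → b , a
      ; 0#      = 0 , 0
      ; 1#      = 1 , 0
      }

    open RawRing differences using () renaming (_+_ to _⊞_; _*_ to _⊠_)

    ι : ℕ → ℝ
    ι a = a • 1#

    -- The case b = 0 is separate so that the numeral 1 evaluates to 1#.
    ⟦_⟧ᶜ : ℕ × ℕ → ℝ
    ⟦ a , ℕ.zero  ⟧ᶜ = ι a
    ⟦ a , ℕ.suc b ⟧ᶜ = ι a - ι (ℕ.suc b)

    ⟦⟧ᶜ-difference : ∀ a b → ⟦ a , b ⟧ᶜ ≈ ι a - ι b
    ⟦⟧ᶜ-difference a ℕ.zero    = sym (trans (+-congˡ -0#≈0#) (+-identityʳ _))
    ⟦⟧ᶜ-difference a (ℕ.suc b) = refl

    interchange : ∀ a b d e → (a + b) + (d + e) ≈ (a + d) + (b + e)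
    interchange a b d e = begin
      (a + b) + (d + e)  ≈⟨ +-assoc a b (d + e) ⟩
      a + (b + (d + e))  ≈⟨ +-congˡ (+-assoc b d e) ⟨
      a + ((b + d) + e)  ≈⟨ +-congˡ (+-congʳ (+-comm b d)) ⟩
      a + ((d + b) + e)  ≈⟨ +-congˡ (+-assoc d b e) ⟩
      a + (d + (b + e))  ≈⟨ +-assoc a d (b + e) ⟨
      (a + d) + (b + e)  ∎
      where open SetoidReasoning setoid

    difference-+ : ∀ a b d e → (a + b) - (d + e) ≈ (a - d) + (b - e)
    difference-+ a b d e =
      trans (+-congˡ (sym (⁻¹-∙-comm d e))) (interchange a b (- d) (- e))

    difference-* : ∀ a b d e → (a * d + b * e) - (a * e + b * d) ≈ (a - b) * (d - e)
    difference-* a b d e = begin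
      (a * d + b * e) - (a * e + b * d)      ≈⟨ difference-+ (a * d) (b * e) (a * e) (b * d) ⟩
      (a * d - a * e) + (b * e - b * d)
        ≈⟨ +-cong (+-congˡ (-‿distribʳ-* a e)) (+-comm (b * e) (- (b * d))) ⟩
      (a * d + a * - e) + (- (b * d) + b * e)
        ≈⟨ +-cong (sym (distribˡ a d (- e)))
             (+-cong (-‿distribˡ-* b d)
               (trans (sym (-‿involutive (b * e)))
                 (trans (-‿cong (-‿distribʳ-* b e)) (-‿distribˡ-* b (- e))))) ⟩
      a * (d - e) + (- b * d + - b * - e)    ≈⟨ +-congˡ (distribˡ (- b) d (- e)) ⟨
      a * (d - e) + - b * (d - e)            ≈⟨ distribʳ (d - e) a (- b) ⟨
      (a - b) * (d - e)                      ∎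
      where open SetoidReasoning setoid

    ⟦cancel⟧ᶜ : ∀ a b → ⟦ cancel a b ⟧ᶜ ≈ ι a - ι b
    ⟦cancel⟧ᶜ ℕ.zero    b         = ⟦⟧ᶜ-difference ℕ.zero b
    ⟦cancel⟧ᶜ (ℕ.suc a) ℕ.zero    = ⟦⟧ᶜ-difference (ℕ.suc a) ℕ.zero
    ⟦cancel⟧ᶜ (ℕ.suc a) (ℕ.suc b) = begin
      ⟦ cancel a b ⟧ᶜ                  ≈⟨ ⟦cancel⟧ᶜ a b ⟩
      ι a - ι b                        ≈⟨ +-identityˡ _ ⟨
      0# + (ι a - ι b)                 ≈⟨ +-congʳ (-‿inverseʳ 1#) ⟨
      (1# - 1#) + (ι a - ι b)          ≈⟨ difference-+ 1# (ι a) 1# (ι b) ⟨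
      (1# + ι a) - (1# + ι b)          ≈⟨ +-cong (×-homo-+ 1# 1 a) (-‿cong (×-homo-+ 1# 1 b)) ⟨
      ι (ℕ.suc a) - ι (ℕ.suc b)        ∎
      where open SetoidReasoning setoid

    evaluation : differences -Raw-AlmostCommutative⟶ fromCommutativeRing commutativeRing
    evaluation = record
      { ⟦_⟧    = ⟦_⟧ᶜ
      ; +-homo = λ (a , b) (a′ , b′) → begin
          ⟦ (a , b) ⊞ (a′ , b′) ⟧ᶜ     ≈⟨ ⟦cancel⟧ᶜ (a ℕ.+ a′) (b ℕ.+ b′) ⟩
          ι (a ℕ.+ a′) - ι (b ℕ.+ b′)
            ≈⟨ +-cong (×-homo-+ 1# a a′) (-‿cong (×-homo-+ 1# b b′)) ⟩
          (ι a + ι a′) - (ι b + ι b′)  ≈⟨ difference-+ (ι a) (ι a′) (ι b) (ι b′) ⟩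
          (ι a - ι b) + (ι a′ - ι b′)
            ≈⟨ +-cong (⟦⟧ᶜ-difference a b) (⟦⟧ᶜ-difference a′ b′) ⟨
          ⟦ a , b ⟧ᶜ + ⟦ a′ , b′ ⟧ᶜ    ∎
      ; *-homo = λ (a , b) (a′ , b′) → begin
          ⟦ (a , b) ⊠ (a′ , b′) ⟧ᶜ
            ≈⟨ ⟦cancel⟧ᶜ (a ℕ.* a′ ℕ.+ b ℕ.* b′) (a ℕ.* b′ ℕ.+ b ℕ.* a′) ⟩
          ι (a ℕ.* a′ ℕ.+ b ℕ.* b′) - ι (a ℕ.* b′ ℕ.+ b ℕ.* a′)
            ≈⟨ +-cong (sumOfProducts a a′ b b′) (-‿cong (sumOfProducts a b′ b a′)) ⟩
          (ι a * ι a′ + ι b * ι b′) - (ι a * ι b′ + ι b * ι a′)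
            ≈⟨ difference-* (ι a) (ι b) (ι a′) (ι b′) ⟩
          (ι a - ι b) * (ι a′ - ι b′)
            ≈⟨ *-cong (⟦⟧ᶜ-difference a b) (⟦⟧ᶜ-difference a′ b′) ⟨
          ⟦ a , b ⟧ᶜ * ⟦ a′ , b′ ⟧ᶜ    ∎
      ; -‿homo = λ (a , b) → begin
          ⟦ b , a ⟧ᶜ          ≈⟨ ⟦⟧ᶜ-difference b a ⟩
          ι b - ι a           ≈⟨ +-comm (ι b) (- ι a) ⟩
          - ι a + ι b         ≈⟨ +-congˡ (-‿involutive (ι b)) ⟨
          - ι a + - - ι b     ≈⟨ ⁻¹-∙-comm (ι a) (- ι b) ⟩
          - (ι a - ι b)       ≈⟨ -‿cong (⟦⟧ᶜ-difference a b) ⟨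
          - ⟦ a , b ⟧ᶜ        ∎
      ; 0-homo = refl
      ; 1-homo = refl
      }
      where
      open SetoidReasoning setoid

      sumOfProducts : ∀ a d b e → ι (a ℕ.* d ℕ.+ b ℕ.* e) ≈ ι a * ι d + ι b * ι e
      sumOfProducts a d b e = trans (×-homo-+ 1# (a ℕ.* d) (b ℕ.* e))
        (+-cong (×1-homo-* a d) (×1-homo-* b e))

    _≟ᶜ_ : WeaklyDecidable (Induced-equivalence evaluation)
    p ≟ᶜ q = Maybe.map (λ p≡q → reflexive (≡.cong ⟦_⟧ᶜ p≡q)) (dec⇒maybe (≡-dec ℕ._≟_ ℕ._≟_ p q))

  open RingSolver differences (fromCommutativeRing commutativeRing) evaluation _≟ᶜ_
    using (Polynomial; solve; con; _:=_; _:+_; _:*_; _:-_; :-_)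

  𝟏 : ∀ {k} → Polynomial k
  𝟏 = con (1 , 0)

  𝟘 : ∀ {k} → Polynomial k
  𝟘 = con (0 , 0)

  0≤-resp : ∀ {x y} → x ≈ y → 0# ≤ x → 0# ≤ y
  0≤-resp = ≤-respʳ-≈

  0<-resp : ∀ {x y} → x ≈ y → 0# < x → 0# < y
  0<-resp x≈y (0≤x , 0≉x) = 0≤-resp x≈y 0≤x , λ 0≈y → 0≉x (trans 0≈y (sym x≈y))

  ≤⇒0≤- : ∀ {x y} → x ≤ y → 0# ≤ y - x
  ≤⇒0≤- {x} x≤y = ≤-respˡ-≈ (-‿inverseʳ x) (+-monoˡ-≤ (- x) x≤y)

  0≤-⇒≤ : ∀ {x y} → 0# ≤ y - x → x ≤ y
  0≤-⇒≤ {x} {y} 0≤y-x = ≤-respˡ-≈ (+-identityˡ x)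
    (≤-respʳ-≈ (solve 2 (λ x y → (y :- x) :+ x := y) refl x y) (+-monoˡ-≤ x 0≤y-x))

  -≈0⇒≈ : ∀ {x y} → y - x ≈ 0# → x ≈ y
  -≈0⇒≈ {x} {y} e = trans (sym (+-identityˡ x))
    (trans (+-congʳ (sym e)) (solve 2 (λ x y → (y :- x) :+ x := y) refl x y))

  <⇒0<- : ∀ {x y} → x < y → 0# < y - x
  <⇒0<- (x≤y , x≉y) = ≤⇒0≤- x≤y , λ e → x≉y (-≈0⇒≈ (sym e))

  0<-⇒< : ∀ {x y} → 0# < y - x → x < y
  0<-⇒< {x} (p , q) = 0≤-⇒≤ p , λ x≈y →
    q (trans (sym (-‿inverseʳ x)) (+-congʳ x≈y))

  +-nonNeg : ∀ {x y} → 0# ≤ x → 0# ≤ y → 0# ≤ x + y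
  +-nonNeg {x} {y} 0≤x 0≤y =
    ≤-trans 0≤y (≤-respˡ-≈ (+-identityˡ y) (+-monoˡ-≤ y 0≤x))

  x+y≈0⇒x≈0 : ∀ {x y} → 0# ≤ x → 0# ≤ y → x + y ≈ 0# → x ≈ 0#
  x+y≈0⇒x≈0 {x} {y} 0≤x 0≤y e = antisym
    (≤-respʳ-≈ e (≤-respˡ-≈ (+-identityˡ x) (≤-respʳ-≈ (+-comm y x) (+-monoˡ-≤ x 0≤y)))) 0≤x

  +-pos : ∀ {x y} → 0# < x → 0# ≤ y → 0# < x + y
  +-pos (0≤x , 0≉x) 0≤y = +-nonNeg 0≤x 0≤y ,
    λ e → 0≉x (sym (x+y≈0⇒x≈0 0≤x 0≤y (sym e)))

  *-cancel-0 : ∀ {x y} → ¬ x ≈ 0# → x * y ≈ 0# → y ≈ 0#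
  *-cancel-0 {x} {y} x≉0 e with inverse x x≉0
  ... | z , xz≈1 = begin
    y             ≈⟨ *-identityˡ y ⟨
    1# * y        ≈⟨ *-congʳ xz≈1 ⟨
    x * z * y     ≈⟨ solve 3 (λ x y z → x :* z :* y := z :* (x :* y)) refl x y z ⟩
    z * (x * y)   ≈⟨ *-congˡ e ⟩
    z * 0#        ≈⟨ zeroʳ z ⟩
    0#            ∎
    where open SetoidReasoning setoid

  *-pos : ∀ {x y} → 0# < x → 0# < y → 0# < x * y
  *-pos (0≤x , 0≉x) (0≤y , 0≉y) = *-nonNeg 0≤x 0≤y ,
    λ e → 0≉y (sym (*-cancel-0 (λ x≈0 → 0≉x (sym x≈0)) (sym e)))

  ≤0⇒0≤- : ∀ {x} → x ≤ 0# → 0# ≤ - x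
  ≤0⇒0≤- {x} x≤0 = 0≤-resp (+-identityˡ (- x)) (≤⇒0≤- x≤0)

  0≤-⇒≤0 : ∀ {x} → 0# ≤ - x → x ≤ 0#
  0≤-⇒≤0 {x} p = 0≤-⇒≤ (0≤-resp (sym (+-identityˡ (- x))) p)

  0<1 : 0# < 1#
  0<1 with total 0# 1#
  ... | inj₁ 0≤1 = 0≤1 , 0≉1
  -- Here 1 = (-1)(-1) is a product of non-negative numbers.
  ... | inj₂ 1≤0 = 0≤-resp (solve 0 (:- 𝟏 :* :- 𝟏 := 𝟏) refl)
                     (*-nonNeg (≤0⇒0≤- 1≤0) (≤0⇒0≤- 1≤0)) , 0≉1

  trichotomy : ∀ x → 0# < - x ⊎ x ≈ 0# ⊎ 0# < x
  trichotomy x with x ≟ 0# | total 0# x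
  ... | yes x≈0 | _        = inj₂ (inj₁ x≈0)
  ... | no  x≉0 | inj₁ 0≤x = inj₂ (inj₂ (0≤x , λ e → x≉0 (sym e)))
  ... | no  x≉0 | inj₂ x≤0 = inj₁ (≤0⇒0≤- x≤0 , λ e → x≉0 (begin
    x      ≈⟨ -‿involutive x ⟨
    - - x  ≈⟨ -‿cong e ⟨
    - 0#   ≈⟨ -0#≈0# ⟩
    0#     ∎))
    where open SetoidReasoning setoid

  0<⇒≉0 : ∀ {x} → 0# < x → ¬ x ≈ 0#
  0<⇒≉0 (_ , 0≉x) x≈0 = 0≉x (sym x≈0)

  0<-⇒≉0 : ∀ {x} → 0# < - x → ¬ x ≈ 0#
  0<-⇒≉0 (_ , 0≉-x) x≈0 = 0≉-x (trans (sym -0#≈0#) (-‿cong (sym x≈0)))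

  0<⇒¬≤0 : ∀ {x} → 0# < x → ¬ x ≤ 0#
  0<⇒¬≤0 (0≤x , 0≉x) x≤0 = 0≉x (antisym 0≤x x≤0)

  -1≉0 : ¬ - 1# ≈ 0#
  -1≉0 = 0<-⇒≉0 (0<-resp (sym (-‿involutive 1#)) 0<1)

  0<inverse : ∀ {x} → 0# < x → ∃[ y ] 0# < y × x * y ≈ 1#
  0<inverse {x} 0<x with inverse x (0<⇒≉0 0<x)
  ... | y , xy≈1 with trichotomy y
  ... | inj₂ (inj₂ 0<y) = y , 0<y , xy≈1
  ... | inj₂ (inj₁ y≈0) =
    contradiction (trans (sym (zeroʳ x)) (trans (*-congˡ (sym y≈0)) xy≈1)) 0≉1
  -- A negative `y` would make x(-y) + 1 positive, while 1 = xy makes it zero.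
  ... | inj₁ 0<-y = contradiction (+-pos (*-pos 0<x 0<-y) (proj₁ 0<1))
    λ 0<0 → proj₂ 0<0 (sym (trans (+-congˡ (sym xy≈1))
      (solve 2 (λ x y → x :* :- y :+ x :* y := 𝟘) refl x y)))

  *-cancel-nonNeg : ∀ {x y} → 0# < x → 0# ≤ x * y → 0# ≤ y
  *-cancel-nonNeg {x} {y} 0<x 0≤xy with 0<inverse 0<x
  ... | z , 0<z , xz≈1 = 0≤-resp
    (trans (solve 3 (λ x y z → z :* (x :* y) := (x :* z) :* y) refl x y z)
      (trans (*-congʳ xz≈1) (*-identityˡ y)))
    (*-nonNeg (proj₁ 0<z) 0≤xy)

  x≤x+y : ∀ {x y} → 0# ≤ y → x ≤ x + y
  x≤x+y {x} {y} 0≤y = 0≤-⇒≤ (0≤-resp (solve 2 (λ x y → y := (x :+ y) :- x) refl x y) 0≤y)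

  y≤x+y : ∀ {x y} → 0# ≤ x → y ≤ x + y
  y≤x+y {x} {y} 0≤x = ≤-respʳ-≈ (+-comm y x) (x≤x+y 0≤x)

  box : ∀ x {y ε} → 0# < ε + y → 0# < ε - y → x - ε < x + y × x + y < x + ε
  box x {y} {ε} 0<ε+y 0<ε-y =
    0<-⇒< (0<-resp (solve 3 (λ x y ε → ε :+ y := (x :+ y) :- (x :- ε)) refl x y ε) 0<ε+y) ,
    0<-⇒< (0<-resp (solve 3 (λ x y ε → ε :- y := (x :+ ε) :- (x :+ y)) refl x y ε) 0<ε-y)

  box-flip : ∀ x {y y′ ε} → - y ≈ y′ → 0# < ε + y → 0# < ε - y → x - ε < x + y′ × x + y′ < x + ε
  box-flip x {y} {y′} -y≈y′ 0<ε+y 0<ε-y = box x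
    (0<-resp (+-congˡ -y≈y′) 0<ε-y)
    (0<-resp (+-congˡ (trans (sym (-‿involutive y)) (-‿cong -y≈y′))) 0<ε+y)

  -- Where b, j are coordinates with ν_b = -1, e_b = 0, ν_j = v and e_j = m, the
  -- points s ν + t e in the box of radius ε = m / (1 + v + m) about ν have |t| ≤ s.
  wedge-bounds : ∀ {s t v m ε} → 0# < m → 0# ≤ v → ε * (1# + v + m) ≈ m →
                 0# < ε + (1# - s) → 0# < ε - (1# - s) →
                 0# < ε + ((s - 1#) * v + t * m) → 0# < ε - ((s - 1#) * v + t * m) →
                 0# ≤ s + t × 0# ≤ s - t
  wedge-bounds {s} {t} {v} {m} {ε} 0<m 0≤v εD≈m p q p′ q′ =
    -- Adding to the box condition at j the two conditions at b with weights v and m cancels the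
    -- term (s - 1)v. What remains is m(s + t), because the multiples of ε add up to ε(1 + v + m) =
    -- m. The bound on s - t arises in the same way.
    *-cancel-nonNeg 0<m (0≤-resp
      (trans (solve 5 (λ s t v m ε →
          (ε :+ ((s :- 𝟏) :* v :+ t :* m)) :+ ((ε :+ (𝟏 :- s)) :* v :+ (ε :- (𝟏 :- s)) :* m)
          := m :* (s :+ t) :+ (ε :* (𝟏 :+ v :+ m) :- m)) refl s t v m ε)
        (absorb (m * (s + t))))
      (+-nonNeg (proj₁ p′)
        (+-nonNeg (*-nonNeg (proj₁ p) 0≤v) (*-nonNeg (proj₁ q) (proj₁ 0<m))))) ,
    *-cancel-nonNeg 0<m (0≤-resp
      (trans (solve 5 (λ s t v m ε →
          (ε :- ((s :- 𝟏) :* v :+ t :* m)) :+ ((ε :- (𝟏 :- s)) :* v :+ (ε :- (𝟏 :- s)) :* m)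
          := m :* (s :- t) :+ (ε :* (𝟏 :+ v :+ m) :- m)) refl s t v m ε)
        (absorb (m * (s - t))))
      (+-nonNeg (proj₁ q′)
        (+-nonNeg (*-nonNeg (proj₁ q) 0≤v) (*-nonNeg (proj₁ q) (proj₁ 0<m)))))
    where
    absorb : ∀ x → x + (ε * (1# + v + m) - m) ≈ x
    absorb x = trans (+-congˡ (trans (+-congʳ εD≈m) (-‿inverseʳ m))) (+-identityʳ x)

  box⁻ : ∀ {x y z ε} → y ≈ x + z → x - ε < y × y < x + ε → 0# < ε + z × 0# < ε - z
  box⁻ {x} {y} {z} {ε} y≈x+z (below , above) =
    0<-resp (trans (+-congʳ y≈x+z)
      (solve 3 (λ x z ε → (x :+ z) :- (x :- ε) := ε :+ z) refl x z ε)) (<⇒0<- below) ,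
    0<-resp (trans (+-congˡ (-‿cong y≈x+z))
      (solve 3 (λ x z ε → (x :+ ε) :- (x :+ z) := ε :- z) refl x z ε)) (<⇒0<- above)

  -- Support functions and linear algebra

  sum-⊕ : ∀ {k} (x y : ℝ^ k) → sum (x ⊕ y) ≈ sum x + sum y
  sum-⊕ = ∑-distrib-+

  sum-⊙ : ∀ {k} t (x : ℝ^ k) → sum (t ⊙ x) ≈ t * sum x
  sum-⊙ t x = sym (*-distribˡ-sum t x)

  sum-𝟎 : ∀ {k} (x : ℝ^ k) → x ≋ 𝟎 → sum x ≈ 0#
  sum-𝟎 {k} x x≋𝟎 = trans (sum-cong-≋ x≋𝟎) (sum-replicate-zero k)

  sum-nonNeg : ∀ {k} (x : ℝ^ k) → (∀ i → 0# ≤ x i) → 0# ≤ sum x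
  sum-nonNeg {ℕ.zero}  x 0≤x = ≤-refl
  sum-nonNeg {ℕ.suc k} x 0≤x = +-nonNeg (0≤x zero) (sum-nonNeg (x ∘ suc) (0≤x ∘ suc))

  ⊖≋-1⊙ : ∀ {k} (x : ℝ^ k) → ⊖ x ≋ (- 1#) ⊙ x
  ⊖≋-1⊙ x i = solve 1 (λ x → :- x := :- 𝟏 :* x) refl (x i)

  sum-⊖ : ∀ {k} (x : ℝ^ k) → sum (⊖ x) ≈ - sum x
  sum-⊖ x = trans (sum-cong-≋ (⊖≋-1⊙ x)) (trans (sum-⊙ (- 1#) x)
    (solve 1 (λ s → :- 𝟏 :* s := :- s) refl (sum x)))

  combination-cong : ∀ {k n} (v : Fin k → ℝ^ n) {x y : ℝ^ k} → x ≋ y →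
                     combination v x ≋ combination v y
  combination-cong v x≋y j = sum-cong-≋ λ i → *-congˡ (x≋y i)

  combination-⊕ : ∀ {k n} (v : Fin k → ℝ^ n) (x y : ℝ^ k) →
                  combination v (x ⊕ y) ≋ combination v x ⊕ combination v y
  combination-⊕ v x y j = trans (sum-cong-≋ λ i → distribˡ (v i j) (x i) (y i))
    (sum-⊕ (λ i → v i j * x i) (λ i → v i j * y i))

  combination-⊙ : ∀ {k n} (v : Fin k → ℝ^ n) t (x : ℝ^ k) →
                  combination v (t ⊙ x) ≋ t ⊙ combination v x
  combination-⊙ v t x j = trans
    (sum-cong-≋ λ i → solve 3 (λ v t x → v :* (t :* x) := t :* (v :* x)) refl (v i j) t (x i))
    (sum-⊙ t (λ i → v i j * x i))

  combination-⊖ : ∀ {k n} (v : Fin k → ℝ^ n) (x : ℝ^ k) →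
                  combination v (⊖ x) ≋ ⊖ combination v x
  combination-⊖ v x j = trans (combination-cong v (⊖≋-1⊙ x) j)
    (trans (combination-⊙ v (- 1#) x j) (sym (⊖≋-1⊙ (combination v x) j)))

  δ : ∀ {k} → Fin k → ℝ^ k
  δ zero    zero    = 1#
  δ zero    (suc _) = 0#
  δ (suc _) zero    = 0#
  δ (suc i) (suc j) = δ i j

  δ-refl : ∀ {k} (i : Fin k) → δ i i ≡ 1#
  δ-refl zero    = ≡.refl
  δ-refl (suc i) = δ-refl i

  δ-≢ : ∀ {k} {i j : Fin k} → i ≢ j → δ i j ≡ 0#
  δ-≢ {i = zero}  {zero}  i≢j = contradiction ≡.refl i≢j
  δ-≢ {i = zero}  {suc _} i≢j = ≡.refl
  δ-≢ {i = suc _} {zero}  i≢j = ≡.refl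
  δ-≢ {i = suc _} {suc _} i≢j = δ-≢ (i≢j ∘ ≡.cong suc)

  δ-nonNeg : ∀ {k} (i j : Fin k) → 0# ≤ δ i j
  δ-nonNeg zero    zero    = proj₁ 0<1
  δ-nonNeg zero    (suc _) = ≤-refl
  δ-nonNeg (suc _) zero    = ≤-refl
  δ-nonNeg (suc i) (suc j) = δ-nonNeg i j

  sum-δ : ∀ {k} (f : ℝ^ k) i → sum (λ j → f j * δ i j) ≈ f i
  sum-δ f zero    = trans
    (+-cong (*-identityʳ _) (sum-𝟎 (λ j → f (suc j) * 0#) λ j → zeroʳ (f (suc j))))
    (+-identityʳ _)
  sum-δ f (suc i) = trans (+-cong (zeroʳ _) (sum-δ (f ∘ suc) i)) (+-identityˡ _)

  -- Sign conditions on the coordinates of A ν for which σ_X(-Aν) is finite.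
  record IsSignCondition (P : Pred ℝ ℓ₂) : Set (c ⊔ ℓ₁ ⊔ ℓ₂) where
    field
      respects  : ∀ {x y} → x ≈ y → P x → P y
      +-closed  : ∀ {x y} → P x → P y → P (x + y)
      *-closed  : ∀ {t x} → 0# ≤ t → P x → P (t * x)
      flat      : ∀ {x m} → P (x + m) → P (x - m) → x ≈ 0# → m ≈ 0#
      dominated : ∀ {x m} → P x → (x ≈ 0# → m ≈ 0#) →
                  ∃[ M ] 0# < M × (∀ t → M ≤ t → P (t * x + m) × P (t * x - m))

  -- The witness is 1 + |m|, with the absolute value replaced by a case distinction.
  bound : ∀ m → ∃[ a ] 0# < a × 0# < a + m × 0# < a - m
  bound m with total 0# m
  ... | inj₁ 0≤m = 1# + m , +-pos 0<1 0≤m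
    , +-pos (+-pos 0<1 0≤m) 0≤m
    , 0<-resp (solve 1 (λ m → 𝟏 := (𝟏 :+ m) :- m) refl m) 0<1
  ... | inj₂ m≤0 = 1# - m , +-pos 0<1 (≤0⇒0≤- m≤0)
    , 0<-resp (solve 1 (λ m → 𝟏 := (𝟏 :- m) :+ m) refl m) 0<1
    , +-pos (+-pos 0<1 (≤0⇒0≤- m≤0)) (≤0⇒0≤- m≤0)

  -- The sum of the thresholds serves as their maximum; this is why each threshold is required to be
  -- positive.
  eventually : ∀ {q k} {Q : Fin k → Pred ℝ q} →
               (∀ i → ∃[ M ] 0# < M × (∀ t → M ≤ t → Q i t)) →
               ∃[ M ] 0# < M × (∀ t → M ≤ t → ∀ i → Q i t)
  eventually {k = ℕ.zero}  Q↑ = 1# , 0<1 , λ t _ ()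
  eventually {k = ℕ.suc k} Q↑ with Q↑ zero | eventually (Q↑ ∘ suc)
  ... | M , 0<M , Q₀ | M′ , 0<M′ , Qₛ = M + M′ , +-pos 0<M (proj₁ 0<M′) , λ where
    t M+M′≤t zero    → Q₀ t (≤-trans (x≤x+y (proj₁ 0<M′)) M+M′≤t)
    t M+M′≤t (suc i) → Qₛ t (≤-trans (y≤x+y (proj₁ 0<M)) M+M′≤t) i

  nonNeg : IsSignCondition (0# ≤_)
  nonNeg = record
    { respects  = 0≤-resp
    ; +-closed  = +-nonNeg
    ; *-closed  = *-nonNeg
    ; flat      = λ p q x≈0 → antisym
        (0≤-⇒≤0 (0≤-resp (trans (+-congʳ x≈0) (+-identityˡ _)) q))
        (0≤-resp (trans (+-congʳ x≈0) (+-identityˡ _)) p)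
    ; dominated = dominated
    }
    where
    dominated : ∀ {x m} → 0# ≤ x → (x ≈ 0# → m ≈ 0#) →
                ∃[ M ] 0# < M × (∀ t → M ≤ t → 0# ≤ t * x + m × 0# ≤ t * x - m)
    dominated {x} {m} 0≤x x≈0⇒m≈0 with x ≟ 0#
    ... | yes x≈0 = 1# , 0<1 , λ t _ →
      ≤-reflexive (sym (begin
        t * x + m    ≈⟨ +-cong (*-congˡ x≈0) (x≈0⇒m≈0 x≈0) ⟩
        t * 0# + 0#  ≈⟨ solve 1 (λ t → t :* 𝟘 :+ 𝟘 := 𝟘) refl t ⟩
        0#           ∎)) ,
      ≤-reflexive (sym (begin
        t * x - m    ≈⟨ +-cong (*-congˡ x≈0) (-‿cong (x≈0⇒m≈0 x≈0)) ⟩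
        t * 0# - 0#  ≈⟨ solve 1 (λ t → t :* 𝟘 :- 𝟘 := 𝟘) refl t ⟩
        0#           ∎))
      where open SetoidReasoning setoid
    ... | no x≉0 with bound m | 0<inverse (0≤x , λ e → x≉0 (sym e))
    -- The threshold is a/x: from there on t x is at least a, which exceeds |m|.
    ... | a , 0<a , 0<a+m , 0<a-m | z , 0<z , xz≈1 = a * z , *-pos 0<a 0<z , λ t az≤t →
      0≤-resp (begin
        (t - a * z) * x + (a + m)
          ≈⟨ solve 5 (λ t a z x m →
               (t :- a :* z) :* x :+ (a :+ m) := (t :* x :+ m) :+ (a :- a :* (x :* z)))
               refl t a z x m ⟩
        (t * x + m) + (a - a * (x * z)) ≈⟨ +-congˡ (rest a) ⟩
        (t * x + m) + 0#               ≈⟨ +-identityʳ _ ⟩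
        t * x + m                      ∎)
        (+-nonNeg (*-nonNeg (≤⇒0≤- az≤t) 0≤x) (proj₁ 0<a+m)) ,
      0≤-resp (begin
        (t - a * z) * x + (a - m)
          ≈⟨ solve 5 (λ t a z x m →
               (t :- a :* z) :* x :+ (a :- m) := (t :* x :- m) :+ (a :- a :* (x :* z)))
               refl t a z x m ⟩
        (t * x - m) + (a - a * (x * z)) ≈⟨ +-congˡ (rest a) ⟩
        (t * x - m) + 0#               ≈⟨ +-identityʳ _ ⟩
        t * x - m                      ∎)
        (+-nonNeg (*-nonNeg (≤⇒0≤- az≤t) 0≤x) (proj₁ 0<a-m))
      where
      open SetoidReasoning setoid

      rest : ∀ a → a - a * (x * z) ≈ 0#
      rest a = begin
        a - a * (x * z)  ≈⟨ +-congˡ (-‿cong (*-congˡ xz≈1)) ⟩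
        a - a * 1#       ≈⟨ solve 1 (λ a → a :- a :* 𝟏 := 𝟘) refl a ⟩
        0#               ∎

  -- Two inequalities in place of an equation put this predicate at the level of `0# ≤_`, so that
  -- one type of sign conditions covers both sets X.
  Null : Pred ℝ ℓ₂
  Null x = 0# ≤ x × x ≤ 0#

  ≈0⇒Null : ∀ {x} → x ≈ 0# → Null x
  ≈0⇒Null x≈0 = ≤-reflexive (sym x≈0) , ≤-reflexive x≈0

  Null⇒≈0 : ∀ {x} → Null x → x ≈ 0#
  Null⇒≈0 (0≤x , x≤0) = antisym x≤0 0≤x

  null : IsSignCondition Null
  null = record
    { respects  = λ x≈y p → ≈0⇒Null (trans (sym x≈y) (Null⇒≈0 p))
    ; +-closed  = λ p q → ≈0⇒Null (trans (+-cong (Null⇒≈0 p) (Null⇒≈0 q)) (+-identityˡ 0#))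
    ; *-closed  = λ _ p → ≈0⇒Null (trans (*-congˡ (Null⇒≈0 p)) (zeroʳ _))
    ; flat      = λ p _ x≈0 → trans (sym (+-identityˡ _))
                    (trans (+-congʳ (sym x≈0)) (Null⇒≈0 p))
    ; dominated = λ {x} {m} p x≈0⇒m≈0 →
        let x≈0 = Null⇒≈0 p
            m≈0 = x≈0⇒m≈0 x≈0
        in 1# , 0<1 , λ t _ →
           ≈0⇒Null (trans (+-cong (*-congˡ x≈0) m≈0)
             (solve 1 (λ t → t :* 𝟘 :+ 𝟘 := 𝟘) refl t)) ,
           ≈0⇒Null (trans (+-cong (*-congˡ x≈0) (-‿cong m≈0))
             (solve 1 (λ t → t :* 𝟘 :- 𝟘 := 𝟘) refl t))
    }

  -- The support function of a convex cone is 0 on its polar cone and infinite elsewhere. `P`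
  -- describes the negative of the polar cone coordinate by coordinate, and everything later uses X
  -- only through this interface.
  record HasPolar {n p} (X : Pred (ℝ^ n) p) (P : Pred ℝ ℓ₂) : Set (c ⊔ ℓ₁ ⊔ ℓ₂ ⊔ p) where
    field
      isSignCondition : IsSignCondition P
      finite⇒sign     : ∀ {y s} → σ X (⊖ y) s → ∀ j → P (y j)
      sign⇒σ≈0        : ∀ {y} → (∀ j → P (y j)) → σ X (⊖ y) 0#

  module _ {n p} {X : Pred (ℝ^ n) p} where

    -- s ≥ y·(x + x′) for all x ∈ X makes s - y·x′ another upper bound.
    σ-finite⇒≤0 : (∀ {x x′} → X x → X x′ → X (x ⊕ x′)) →
                  ∀ {y s} → σ X y s → ∀ {x} → X x → y · x ≤ 0#
    σ-finite⇒≤0 X-⊕ {y} {s} (upper , least) {x′} Xx′ = 0≤-⇒≤0 (0≤-resp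
      (solve 2 (λ s t → (s :- t) :- s := :- t) refl s (y · x′))
      (≤⇒0≤- (least (s - y · x′) λ (x , Xx) → 0≤-⇒≤ (0≤-resp (begin
        s - y · (x ⊕ x′)
          ≈⟨ +-congˡ (-‿cong (trans (sum-cong-≋ λ i → distribˡ (y i) (x i) (x′ i))
                                    (sum-⊕ (λ i → y i * x i) (λ i → y i * x′ i)))) ⟩
        s - (y · x + y · x′)
          ≈⟨ solve 3 (λ s a b → s :- (a :+ b) := (s :- b) :- a) refl s (y · x) (y · x′) ⟩
        (s - y · x′) - y · x   ∎)
        (≤⇒0≤- (upper (x ⊕ x′ , X-⊕ Xx Xx′)))))))
      where open SetoidReasoning setoid

    -- The origin attains the value 0, so no smaller upper bound exists.
    σ≈0 : X 𝟎 → ∀ {y} → (∀ {x} → X x → y · x ≤ 0#) → σ X y 0#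
    σ≈0 X𝟎 {y} y·x≤0 = (λ (x , Xx) → y·x≤0 Xx) ,
      λ u u-upper → ≤-respˡ-≈ (sum-𝟎 (λ i → y i * 0#) λ i → zeroʳ (y i)) (u-upper (𝟎 , X𝟎))

  ⊖-·-δ : ∀ {n} (y : ℝ^ n) j → (⊖ y) · δ j ≈ - y j
  ⊖-·-δ y j = sum-δ (⊖ y) j

  ⊖-·-⊖δ : ∀ {n} (y : ℝ^ n) j → (⊖ y) · (⊖ δ j) ≈ y j
  ⊖-·-⊖δ y j = trans
    (sum-cong-≋ λ i → solve 2 (λ y d → :- y :* :- d := y :* d) refl (y i) (δ j i))
    (sum-δ y j)

  ⊖-· : ∀ {n} (y x : ℝ^ n) → (⊖ y) · x ≈ - (y · x)
  ⊖-· y x = trans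
    (sum-cong-≋ λ i → solve 2 (λ y x → :- y :* x := :- (y :* x)) refl (y i) (x i))
    (sum-⊖ (λ i → y i * x i))

  -- The unit vectors lie in the orthant, and testing -y against them yields the sign of each
  -- coordinate. For the whole space their negatives are available too, which gives both
  -- inequalities.
  orthant-polar : ∀ {n} → HasPolar (Orthant {n}) (0# ≤_)
  orthant-polar = record
    { isSignCondition = nonNeg
    ; finite⇒sign = λ {y} σ-finite j →
        0≤-resp (solve 1 (λ y → :- :- y := y) refl (y j)) (≤0⇒0≤- (≤-respˡ-≈ (⊖-·-δ y j)
          (σ-finite⇒≤0 (λ 0≤x 0≤x′ i → +-nonNeg (0≤x i) (0≤x′ i)) σ-finite (δ-nonNeg j))))
    ; sign⇒σ≈0 = λ {y} 0≤y → σ≈0 {X = Orthant} (λ _ → ≤-refl) λ {x} 0≤x →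
        0≤-⇒≤0 (0≤-resp
          (trans (solve 1 (λ a → a := :- :- a) refl (y · x)) (-‿cong (sym (⊖-· y x))))
          (sum-nonNeg (λ i → y i * x i) λ i → *-nonNeg (0≤y i) (0≤x i)))
    }

  U-polar : ∀ {n} → HasPolar {n} U Null
  U-polar = record
    { isSignCondition = null
    ; finite⇒sign = λ {y} σ-finite j →
        let ≤0 = λ x → σ-finite⇒≤0 {X = U} (λ _ _ → _) σ-finite {x} _ in
        0≤-resp (solve 1 (λ y → :- :- y := y) refl (y j))
          (≤0⇒0≤- (≤-respˡ-≈ (⊖-·-δ y j) (≤0 (δ j)))) ,
        ≤-respˡ-≈ (⊖-·-⊖δ y j) (≤0 (⊖ δ j))
    ; sign⇒σ≈0 = λ {y} y≈0 → σ≈0 {X = U} _ λ {x} _ → ≤-reflexive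
        (sum-𝟎 (λ i → - y i * x i) λ i → trans (*-congʳ (-‿cong (Null⇒≈0 (y≈0 i))))
          (solve 1 (λ x → :- 𝟘 :* x := 𝟘) refl (x i)))
    }

  -- Circuits as extreme rays

  ≋-sym : ∀ {k} {x y : ℝ^ k} → x ≋ y → y ≋ x
  ≋-sym x≋y i = sym (x≋y i)

  -- The directions along which no constraint active at ν changes.
  record Flat {n} (A : SupportSet n) (ν μ : ℝ^ˢ A) : Set (c ⊔ ℓ₁) where
    field
      support   : ∀ i → ν i ≈ 0# → μ i ≈ 0#
      balanced  : sum μ ≈ 0#
      kernel    : ∀ j → (A ∙ ν) j ≈ 0# → (A ∙ μ) j ≈ 0#

  Extreme : ∀ {n} (A : SupportSet n) → ℝ^ˢ A → Set (c ⊔ ℓ₁)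
  Extreme A ν = ∀ μ → Flat A ν μ → ∃[ t ] μ ≋ t ⊙ ν

  module _ {n} {A : SupportSet n} {ν : ℝ^ˢ A} where

    Flat-⊙ : ∀ t {μ} → Flat A ν μ → Flat A ν (t ⊙ μ)
    Flat-⊙ t {μ} flat = record
      { support  = λ i νᵢ≈0 → trans (*-congˡ (F.support i νᵢ≈0)) (zeroʳ t)
      ; balanced = trans (sum-⊙ t μ) (trans (*-congˡ F.balanced) (zeroʳ t))
      ; kernel   = λ j Aνⱼ≈0 → trans (combination-⊙ (A [_]) t μ j)
                     (trans (*-congˡ (F.kernel j Aνⱼ≈0)) (zeroʳ t))
      }
      where module F = Flat flat

    Flat-⊕ : ∀ {μ μ′} → Flat A ν μ → Flat A ν μ′ → Flat A ν (μ ⊕ μ′)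
    Flat-⊕ {μ} {μ′} flat flat′ = record
      { support  = λ i νᵢ≈0 → +≈0 (F.support i νᵢ≈0) (F′.support i νᵢ≈0)
      ; balanced = trans (sum-⊕ μ μ′) (+≈0 F.balanced F′.balanced)
      ; kernel   = λ j Aνⱼ≈0 → trans (combination-⊕ (A [_]) μ μ′ j)
                     (+≈0 (F.kernel j Aνⱼ≈0) (F′.kernel j Aνⱼ≈0))
      }
      where
      module F = Flat flat
      module F′ = Flat flat′

      +≈0 : ∀ {x y} → x ≈ 0# → y ≈ 0# → x + y ≈ 0#
      +≈0 x≈0 y≈0 = trans (+-cong x≈0 y≈0) (+-identityˡ 0#)

    Flat-⊖ : ∀ {μ} → Flat A ν μ → Flat A ν (⊖ μ)
    Flat-⊖ {μ} flat = record
      { support  = λ i νᵢ≈0 → trans (⊖≋-1⊙ μ i) (F.support i νᵢ≈0)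
      ; balanced = trans (sum-cong-≋ (⊖≋-1⊙ μ)) F.balanced
      ; kernel   = λ j Aνⱼ≈0 → trans (combination-cong (A [_]) (⊖≋-1⊙ μ) j) (F.kernel j Aνⱼ≈0)
      }
      where module F = Flat (Flat-⊙ (- 1#) flat)

    Flat-self : sum ν ≈ 0# → Flat A ν ν
    Flat-self ∑ν≈0 = record
      { support  = λ _ νᵢ≈0 → νᵢ≈0
      ; balanced = ∑ν≈0
      ; kernel   = λ _ Aνⱼ≈0 → Aνⱼ≈0
      }

    module _ (extreme : Extreme A ν) where

      multiple-of-scaled : ∀ {s d} → 0# < s → Flat A ν (s ⊙ d) → ∃[ t ] d ≋ t ⊙ ν
      multiple-of-scaled {s} {d} 0<s flat with extreme (s ⊙ d) flat | 0<inverse 0<s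
      ... | t , sd≋tν | r , _ , sr≈1 = r * t , λ i → begin
        d i             ≈⟨ *-identityˡ (d i) ⟨
        1# * d i        ≈⟨ *-congʳ sr≈1 ⟨
        s * r * d i     ≈⟨ solve 3 (λ s r d → s :* r :* d := r :* (s :* d)) refl s r (d i) ⟩
        r * (s * d i)   ≈⟨ *-congˡ (sd≋tν i) ⟩
        r * (t * ν i)   ≈⟨ *-assoc r t (ν i) ⟨
        r * t * ν i     ∎
        where open SetoidReasoning setoid

  small-multiple : ∀ {k} (d : ℝ^ k) {ε} → 0# < ε →
                   ∃[ s ] 0# < s × (∀ i → 0# < ε + s * d i × 0# < ε - s * d i)
  small-multiple d {ε} 0<ε
    with eventually (λ i → let a , 0<a , 0<a+d , 0<a-d = bound (d i) in
           a , 0<a , λ t a≤t →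
             0<-resp (solve 3 (λ a d t → (a :+ d) :+ (t :- a) := t :+ d) refl a (d i) t)
               (+-pos 0<a+d (≤⇒0≤- a≤t)) ,
             0<-resp (solve 3 (λ a d t → (a :- d) :+ (t :- a) := t :- d) refl a (d i) t)
               (+-pos 0<a-d (≤⇒0≤- a≤t)))
  ... | M , 0<M , |d|<M with 0<inverse 0<M
  ... | z , 0<z , Mz≈1 = s , 0<s , λ i →
    let 0<M+d , 0<M-d = |d|<M M ≤-refl i in
    0<-resp (trans
      (solve 4 (λ ε z M d → ε :* z :* (M :+ d) := ε :* (M :* z) :+ ε :* z :* d)
        refl ε z M (d i))
      (+-congʳ sM≈ε)) (*-pos 0<s 0<M+d) ,
    0<-resp (trans
      (solve 4 (λ ε z M d → ε :* z :* (M :- d) := ε :* (M :* z) :- ε :* z :* d)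
        refl ε z M (d i))
      (+-congʳ sM≈ε)) (*-pos 0<s 0<M-d)
    where
    -- Since `M` exceeds every |d i| and `z` is its inverse, the step ε/M moves each coordinate by
    -- less than ε.
    s = ε * z
    0<s = *-pos 0<ε 0<z

    sM≈ε : ε * (M * z) ≈ ε
    sM≈ε = trans (*-congˡ Mz≈1) (*-identityʳ ε)

  -- A relative interior allows movement only within the affine hull. Differences of points of C are
  -- directions of the hull, as the weights 1, s, -s show.
  affine-direction : ∀ {p k} (C : Pred (ℝ^ k) p) {x u v} → C x → C u → C v →
                    ∀ s → AffineHull C (x ⊕ s ⊙ (u ⊕ ⊖ v))
  affine-direction C {x} {u} {v} Cx Cu Cv s = 3
    , (λ { zero → x ; (suc zero) → u ; (suc (suc zero)) → v })
    , (λ { zero → 1# ; (suc zero) → s ; (suc (suc zero)) → - s })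
    , (λ { zero → Cx ; (suc zero) → Cu ; (suc (suc zero)) → Cv })
    , solve 1 (λ s → 𝟏 :+ (s :+ (:- s :+ 𝟘)) := 𝟏) refl s
    , λ j → solve 4 (λ x u v s → x :+ s :* (u :- v) := x :* 𝟏 :+ (u :* s :+ (v :* :- s :+ 𝟘)))
              refl (x j) (u j) (v j) s

  -- With v₁ - v₀ = t₁ν and v₂ - v₀ = t₂ν, the affine relation t₂(v₁ - v₀) = t₁(v₂ - v₀) has weights
  -- t₁ - t₂, t₂, -t₁. Independence gives t₁ = 0, hence v₁ = v₀, which is an affine relation with
  -- weights -1, 1, 0.
  multiples-dependent : ∀ {k} {ν : ℝ^ k} (v : Fin 3 → ℝ^ k) →
                        (∃[ t ] v (suc zero) ⊕ ⊖ v zero ≋ t ⊙ ν) →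
                        (∃[ t ] v (suc (suc zero)) ⊕ ⊖ v zero ≋ t ⊙ ν) →
                        ¬ AffinelyIndependent v
  multiples-dependent {ν = ν} v (t₁ , d₁≋) (t₂ , d₂≋) independent =
    0≉1 (sym (independent difference
      (solve 1 (λ a → :- a :+ (a :+ (𝟘 :+ 𝟘)) := 𝟘) refl 1#)
      (λ j → begin
        v zero j * - 1# + (v (suc zero) j * 1# + (v (suc (suc zero)) j * 0# + 0#))
          ≈⟨ solve 3 (λ a b d → a :* :- 𝟏 :+ (b :* 𝟏 :+ (d :* 𝟘 :+ 𝟘)) := b :- a) refl
            (v zero j) (v (suc zero) j) (v (suc (suc zero)) j) ⟩
        v (suc zero) j - v zero j  ≈⟨ d₁≋ j ⟩
        t₁ * ν j                   ≈⟨ *-congʳ t₁≈0 ⟩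
        0# * ν j                   ≈⟨ zeroˡ (ν j) ⟩
        0#                         ∎)
      (suc zero)))
    where
    open SetoidReasoning setoid

    difference relation : ℝ^ 3
    difference zero                = - 1#
    difference (suc zero)          = 1#
    difference (suc (suc zero))    = 0#
    relation   zero                = t₁ - t₂
    relation   (suc zero)          = t₂
    relation   (suc (suc zero))    = - t₁

    t₁≈0 : t₁ ≈ 0#
    t₁≈0 = trans (solve 1 (λ t → t := :- :- t) refl t₁) (trans (-‿cong (independent relation
      (solve 2 (λ t₁ t₂ → (t₁ :- t₂) :+ (t₂ :+ (:- t₁ :+ 𝟘)) := 𝟘) refl t₁ t₂)
      (λ j → begin
        v zero j * (t₁ - t₂) + (v (suc zero) j * t₂ + (v (suc (suc zero)) j * - t₁ + 0#))
          ≈⟨ solve 5 (λ a b d t₁ t₂ →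
               a :* (t₁ :- t₂) :+ (b :* t₂ :+ (d :* :- t₁ :+ 𝟘)) :=
               t₂ :* (b :- a) :- t₁ :* (d :- a))
               refl (v zero j) (v (suc zero) j) (v (suc (suc zero)) j) t₁ t₂ ⟩
        t₂ * (v (suc zero) j - v zero j) - t₁ * (v (suc (suc zero)) j - v zero j)
          ≈⟨ +-cong (*-congˡ (d₁≋ j)) (-‿cong (*-congˡ (d₂≋ j))) ⟩
        t₂ * (t₁ * ν j) - t₁ * (t₂ * ν j)
          ≈⟨ solve 3 (λ t₁ t₂ ν → t₂ :* (t₁ :* ν) :- t₁ :* (t₂ :* ν) := 𝟘) refl t₁ t₂ (ν j) ⟩
        0#  ∎)
      (suc (suc zero)))) (trans (⊖≋-1⊙ {1} 𝟎 zero) (zeroʳ (- 1#))))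

  module Feasibility {n} {P : Pred ℝ ℓ₂} (sign : IsSignCondition P)
                     (A : SupportSet n) (β : ℝ^ n) where

    module P = IsSignCondition sign

    -- The cone K, when `P` is the sign condition that `HasPolar` attaches to X.
    Feasible : Pred (ℝ^ˢ A) (ℓ₁ ⊔ ℓ₂)
    Feasible μ = N A β μ × (∀ j → P ((A ∙ μ) j))

    Feasible-resp : ∀ {μ μ′} → μ ≋ μ′ → Feasible μ → Feasible μ′
    Feasible-resp μ≋μ′ ((0≤μ , ∑μ≈0) , Pμ) =
      ((λ i A[i]≢β → 0≤-resp (μ≋μ′ i) (0≤μ i A[i]≢β)) ,
       trans (sum-cong-≋ (≋-sym μ≋μ′)) ∑μ≈0) ,
      λ j → P.respects (combination-cong (A [_]) μ≋μ′ j) (Pμ j)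

    Feasible-⊕ : ∀ {μ μ′} → Feasible μ → Feasible μ′ → Feasible (μ ⊕ μ′)
    Feasible-⊕ {μ} {μ′} ((0≤μ , ∑μ≈0) , Pμ) ((0≤μ′ , ∑μ′≈0) , Pμ′) =
      ((λ i A[i]≢β → +-nonNeg (0≤μ i A[i]≢β) (0≤μ′ i A[i]≢β)) ,
       trans (sum-⊕ μ μ′) (trans (+-cong ∑μ≈0 ∑μ′≈0) (+-identityˡ 0#))) ,
      λ j → P.respects (sym (combination-⊕ (A [_]) μ μ′ j)) (P.+-closed (Pμ j) (Pμ′ j))

    Feasible-⊙ : ∀ {t μ} → 0# ≤ t → Feasible μ → Feasible (t ⊙ μ)
    Feasible-⊙ {t} {μ} 0≤t ((0≤μ , ∑μ≈0) , Pμ) =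
      ((λ i A[i]≢β → *-nonNeg 0≤t (0≤μ i A[i]≢β)) ,
       trans (sum-⊙ t μ) (trans (*-congˡ ∑μ≈0) (zeroʳ t))) ,
      λ j → P.respects (sym (combination-⊙ (A [_]) t μ j)) (P.*-closed 0≤t (Pμ j))

    module _ {ν : ℝ^ˢ A} {b : Fin (card A)}
             (unique : ∀ i → A [ i ] ≋ β → i ≡ b) (νb≈-1 : ν b ≈ - 1#)
             (feasible : Feasible ν) where

      segment⇒Flat : ∀ {d} → Feasible (ν ⊕ d) → Feasible (ν ⊕ ⊖ d) → Flat A ν d
      segment⇒Flat {d} ((0≤ν+d , ∑≈0) , Pν+d) ((0≤ν-d , _) , Pν-d) = record
        { support  = λ i νᵢ≈0 →
            -- A zero of ν cannot be the position of β, where ν is -1; hence the entry there does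
            -- carry a sign constraint, and it cannot move both ways.
            let A[i]≢β = λ e → -1≉0 (trans (sym νb≈-1)
                  (trans (reflexive (≡.cong ν (≡.sym (unique i e)))) νᵢ≈0))
            in IsSignCondition.flat nonNeg (0≤ν+d i A[i]≢β) (0≤ν-d i A[i]≢β) νᵢ≈0
        ; balanced = begin
            sum d                 ≈⟨ +-identityˡ (sum d) ⟨
            0# + sum d            ≈⟨ +-congʳ (proj₂ (proj₁ feasible)) ⟨
            sum ν + sum d         ≈⟨ sum-⊕ ν d ⟨
            sum (ν ⊕ d)           ≈⟨ ∑≈0 ⟩
            0#                    ∎
        ; kernel   = λ j → P.flat (P.respects (combination-⊕ (A [_]) ν d j) (Pν+d j))
            (P.respects (trans (combination-⊕ (A [_]) ν (⊖ d) j)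
              (+-congˡ (combination-⊖ (A [_]) d j))) (Pν-d j))
        }
        where open SetoidReasoning setoid

      -- Where a constraint is active at ν, the direction does not affect it; every other constraint
      -- is strict at ν and survives once ν is multiplied by a large number. Scaling ν up instead of
      -- μ down postpones the division.
      Flat⇒segment : ∀ {μ} → Flat A ν μ →
                     ∃[ M ] 0# < M × Feasible (M ⊙ ν ⊕ μ) × Feasible (M ⊙ ν ⊕ ⊖ μ)
      Flat⇒segment {μ} flat
        with eventually coordinates | eventually
          (λ j → P.dominated (proj₂ feasible j) (Flat.kernel flat j))
        where
        coordinates : ∀ i → ∃[ M ] 0# < M × (∀ t → M ≤ t → ¬ A [ i ] ≋ β →
                      0# ≤ t * ν i + μ i × 0# ≤ t * ν i - μ i)
        coordinates i with (A [ i ]) ≋? β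
        -- The entry at β is unconstrained, so any positive threshold will do.
        ... | yes A[i]≋β = 1# , 0<1 , λ _ _ A[i]≢β → contradiction A[i]≋β A[i]≢β
        ... | no  A[i]≢β
          with IsSignCondition.dominated nonNeg (proj₁ (proj₁ feasible) i A[i]≢β)
            (Flat.support flat i)
        ... | M , 0<M , dom = M , 0<M , λ t M≤t _ → dom t M≤t
      ... | M₁ , 0<M₁ , Q₁ | M₂ , 0<M₂ , Q₂ = M , +-pos 0<M₁ (proj₁ 0<M₂) ,
        (((λ i A[i]≢β → proj₁ (q₁ i A[i]≢β)) , balanced (Flat.balanced flat)) ,
          λ j → P.respects
            (sym (trans (combination-⊕ (A [_]) (M ⊙ ν) μ j)
            (+-congʳ (combination-⊙ (A [_]) M ν j)))) (proj₁ (q₂ j))) ,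
        (((λ i A[i]≢β → proj₂ (q₁ i A[i]≢β)) , balanced (Flat.balanced (Flat-⊖ flat))) ,
          λ j → P.respects
            (sym (trans (combination-⊕ (A [_]) (M ⊙ ν) (⊖ μ) j)
            (+-cong (combination-⊙ (A [_]) M ν j) (combination-⊖ (A [_]) μ j)))) (proj₂ (q₂ j)))
        where
        M  = M₁ + M₂
        q₁ = Q₁ M (x≤x+y (proj₁ 0<M₂))
        q₂ = Q₂ M (y≤x+y (proj₁ 0<M₁))

        balanced : ∀ {μ} → sum μ ≈ 0# → sum (M ⊙ ν ⊕ μ) ≈ 0#
        balanced {μ} ∑μ≈0 = trans (sum-⊕ (M ⊙ ν) μ)
          (trans (+-cong (trans (sum-⊙ M ν) (*-congˡ (proj₂ (proj₁ feasible)))) ∑μ≈0)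
            (solve 1 (λ M → M :* 𝟘 :+ 𝟘 := 𝟘) refl M))

      module _ (extreme : Extreme A ν) (C : Pred (ℝ^ˢ A) (c ⊔ ℓ₁ ⊔ ℓ₂)) (C⊆ : C ⊆ Feasible) where

        Extreme⇒¬interior : HasDimension C 2 → ¬ RelativeInterior C ν
        Extreme⇒¬interior (v , Cv , independent , _) (Cν , ε , 0<ε , interior) =
          multiples-dependent v (multiple (suc zero)) (multiple (suc (suc zero))) independent
          where
          multiple : ∀ k → ∃[ t ] v k ⊕ ⊖ v zero ≋ t ⊙ ν
          multiple k = multiple-of-scaled extreme {s} {d} 0<s
            (segment⇒Flat {s ⊙ d} (C⊆ {ν ⊕ s ⊙ d} forward)
              (Feasible-resp {ν ⊕ s ⊙ e} {ν ⊕ ⊖ (s ⊙ d)} (λ i → +-congˡ (sym (opposite i)))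
                (C⊆ {ν ⊕ s ⊙ e} backward)))
            where
            -- `e` is -d, again written as a difference of two points of C so that
            -- `affine-direction` applies to the backward step as well.
            d e : ℝ^ˢ A
            d = v k ⊕ ⊖ v zero
            e = v zero ⊕ ⊖ v k

            scale = small-multiple d 0<ε
            s     = proj₁ scale
            0<s   = proj₁ (proj₂ scale)
            small = proj₂ (proj₂ scale)

            opposite : ∀ i → - (s * d i) ≈ s * e i
            opposite i = solve 3 (λ u v s → :- (s :* (v :- u)) := s :* (u :- v)) refl (v zero i)
              (v k i) s

            forward : C (ν ⊕ s ⊙ d)
            forward = interior (ν ⊕ s ⊙ d) (affine-direction C Cν (Cv k) (Cv zero) s)
              λ i → box (ν i) (proj₁ (small i)) (proj₂ (small i))

            backward : C (ν ⊕ s ⊙ e)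
            backward = interior (ν ⊕ s ⊙ e) (affine-direction C Cν (Cv zero) (Cv k) s)
              λ i → box-flip (ν i) (opposite i) (proj₁ (small i)) (proj₂ (small i))

      -- The cone of all feasible vectors in the plane of ν and e: a two-dimensional cone with ν in
      -- its relative interior. The coordinates b, where e vanishes and ν is -1, and j, where e is
      -- positive, show that ν and e are independent and determine the coefficients s and t.
      module Wedge {e : ℝ^ˢ A} {j : Fin (card A)}
                   (ν+e : Feasible (ν ⊕ e)) (ν-e : Feasible (ν ⊕ ⊖ e))
                   (eb≈0 : e b ≈ 0#) (0<ej : 0# < e j) (0≤νj : 0# ≤ ν j) where

        span : ℝ → ℝ → ℝ^ˢ A
        span s t = s ⊙ ν ⊕ t ⊙ e

        Wedge : Pred (ℝ^ˢ A) (c ⊔ ℓ₁ ⊔ ℓ₂)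
        Wedge y = Feasible y × ∃[ s ] ∃[ t ] y ≋ span s t

        wedge-cone : IsConvexCone Wedge
        wedge-cone = record
          { respects = λ x≋y (feasible , s , t , x≋) →
              Feasible-resp x≋y feasible , s , t , λ i → trans (sym (x≋y i)) (x≋ i)
          ; closed   = λ {p} {q} {x} {y} 0<p 0<q (fx , s , t , x≋) (fy , s′ , t′ , y≋) →
              Feasible-⊕ {p ⊙ x} {q ⊙ y}
                (Feasible-⊙ (proj₁ 0<p) fx) (Feasible-⊙ (proj₁ 0<q) fy) ,
              p * s + q * s′ , p * t + q * t′ , λ i → trans
                (+-cong (*-congˡ (x≋ i)) (*-congˡ (y≋ i)))
                (combine p q s s′ t t′ (ν i) (e i))
          }
          where
          combine : ∀ p q s s′ t t′ x y → p * (s * x + t * y) + q * (s′ * x + t′ * y) ≈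
                    (p * s + q * s′) * x + (p * t + q * t′) * y
          combine = solve 8 (λ p q s s′ t t′ x y →
            p :* (s :* x :+ t :* y) :+ q :* (s′ :* x :+ t′ :* y) :=
            (p :* s :+ q :* s′) :* x :+ (p :* t :+ q :* t′) :* y) refl

        -- For |t| ≤ s the vector s ν + t e lies in the cone generated by ν and ν + e if t is
        -- non-negative, and in the cone generated by ν and ν - e otherwise.
        span-feasible : ∀ {s t} → 0# ≤ s + t → 0# ≤ s - t → Feasible (span s t)
        span-feasible {s} {t} 0≤s+t 0≤s-t with total 0# t
        ... | inj₁ 0≤t = Feasible-resp {(s - t) ⊙ ν ⊕ t ⊙ (ν ⊕ e)} {span s t}
          (λ i → solve 4 (λ s t x y → (s :- t) :* x :+ t :* (x :+ y) := s :* x :+ t :* y)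
                   refl s t (ν i) (e i))
          (Feasible-⊕ {(s - t) ⊙ ν} {t ⊙ (ν ⊕ e)} (Feasible-⊙ 0≤s-t feasible)
            (Feasible-⊙ 0≤t ν+e))
        ... | inj₂ t≤0 = Feasible-resp {(s + t) ⊙ ν ⊕ (- t) ⊙ (ν ⊕ ⊖ e)} {span s t}
          (λ i → solve 4 (λ s t x y → (s :+ t) :* x :+ :- t :* (x :- y) := s :* x :+ t :* y)
                   refl s t (ν i) (e i))
          (Feasible-⊕ {(s + t) ⊙ ν} {(- t) ⊙ (ν ⊕ ⊖ e)} (Feasible-⊙ 0≤s+t feasible)
            (Feasible-⊙ (≤0⇒0≤- t≤0) ν-e))

        ν∈wedge : Wedge ν
        ν∈wedge = feasible , 1# , 0# , λ i →
          solve 2 (λ x y → x := 𝟏 :* x :+ 𝟘 :* y) refl (ν i) (e i)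

        -- The line through ν and 2ν passes through the origin, so the affine span of these three
        -- points is the linear span of ν and e.
        points₃ : Fin 3 → ℝ^ˢ A
        points₃ zero             = ν
        points₃ (suc zero)       = (1# + 1#) ⊙ ν
        points₃ (suc (suc zero)) = ν ⊕ e

        points₃∈wedge : ∀ i → Wedge (points₃ i)
        points₃∈wedge zero             = ν∈wedge
        points₃∈wedge (suc zero)       =
          Feasible-⊙ (+-nonNeg (proj₁ 0<1) (proj₁ 0<1)) feasible , 1# + 1# , 0# , λ i →
          solve 2 (λ x y → (𝟏 :+ 𝟏) :* x := (𝟏 :+ 𝟏) :* x :+ 𝟘 :* y) refl (ν i) (e i)
        points₃∈wedge (suc (suc zero)) = ν+e , 1# , 1# , λ i →
          solve 2 (λ x y → x :+ y := 𝟏 :* x :+ 𝟏 :* y) refl (ν i) (e i)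

        combination₃ : ∀ w i → combination points₃ w i ≈
                       ν i * (sum w + w (suc zero)) + e i * w (suc (suc zero))
        combination₃ w i = solve 5 (λ x y w₀ w₁ w₂ →
          x :* w₀ :+ ((𝟏 :+ 𝟏) :* x :* w₁ :+ ((x :+ y) :* w₂ :+ 𝟘)) :=
          x :* ((w₀ :+ (w₁ :+ (w₂ :+ 𝟘))) :+ w₁) :+ y :* w₂)
          refl (ν i) (e i) (w zero) (w (suc zero)) (w (suc (suc zero)))

        points₃-independent : AffinelyIndependent points₃
        points₃-independent w ∑w≈0 comb≋𝟎 = λ where
            zero             → w₀≈0
            (suc zero)       → w₁≈0
            (suc (suc zero)) → w₂≈0
          where
          open SetoidReasoning setoid
          w₀ = w zero
          w₁ = w (suc zero)
          w₂ = w (suc (suc zero))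

          relation : ∀ i → ν i * (0# + w₁) + e i * w₂ ≈ 0#
          relation i = trans (+-congʳ (*-congˡ (+-congʳ (sym ∑w≈0))))
            (trans (sym (combination₃ w i)) (comb≋𝟎 i))

          -- At b only ν contributes, which isolates w₁; at j the term of ν is then gone, which
          -- isolates w₂.
          w₁≈0 : w₁ ≈ 0#
          w₁≈0 = *-cancel-0 -1≉0 (begin
            - 1# * w₁
              ≈⟨ solve 2 (λ w₁ w₂ → :- 𝟏 :* w₁ := :- 𝟏 :* (𝟘 :+ w₁) :+ 𝟘 :* w₂) refl w₁ w₂ ⟩
            - 1# * (0# + w₁) + 0# * w₂     ≈⟨ +-cong (*-congʳ νb≈-1) (*-congʳ eb≈0) ⟨
            ν b * (0# + w₁) + e b * w₂     ≈⟨ relation b ⟩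
            0#                             ∎)

          w₂≈0 : w₂ ≈ 0#
          w₂≈0 = *-cancel-0 (0<⇒≉0 0<ej) (begin
            e j * w₂
              ≈⟨ solve 3 (λ x y w₂ → y :* w₂ := x :* (𝟘 :+ 𝟘) :+ y :* w₂) refl (ν j) (e j) w₂ ⟩
            ν j * (0# + 0#) + e j * w₂     ≈⟨ +-congʳ (*-congˡ (+-congˡ w₁≈0)) ⟨
            ν j * (0# + w₁) + e j * w₂     ≈⟨ relation j ⟩
            0#                             ∎)

          w₀≈0 : w₀ ≈ 0#
          w₀≈0 = begin
            w₀
              ≈⟨ solve 1 (λ w₀ → w₀ := w₀ :+ (𝟘 :+ (𝟘 :+ 𝟘))) refl w₀ ⟩
            w₀ + (0# + (0# + 0#))          ≈⟨ +-congˡ (+-cong w₁≈0 (+-congʳ w₂≈0)) ⟨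
            w₀ + (w₁ + (w₂ + 0#))          ≈⟨ ∑w≈0 ⟩
            0#                             ∎

        wedge-dimension : HasDimension Wedge 2
        wedge-dimension = points₃ , points₃∈wedge , points₃-independent ,
          λ (_ , s , t , x≋) → weights s t , weights-sum s t ,
            λ i → trans (x≋ i) (weights-combination s t (ν i) (e i))
          where
          -- The solution of w₀ + 2w₁ + w₂ = s and w₂ = t with total weight 1.
          weights : ℝ → ℝ → ℝ^ 3
          weights s t zero             = 1# - (s - 1#) - t
          weights s t (suc zero)       = s - 1#
          weights s t (suc (suc zero)) = t

          weights-sum : ∀ s t → sum (weights s t) ≈ 1#
          weights-sum = solve 2 (λ s t →
            (𝟏 :- (s :- 𝟏) :- t) :+ ((s :- 𝟏) :+ (t :+ 𝟘)) := 𝟏) refl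

          weights-combination : ∀ s t x y → s * x + t * y ≈
            x * (1# - (s - 1#) - t) + ((1# + 1#) * x * (s - 1#) + ((x + y) * t + 0#))
          weights-combination = solve 4 (λ s t x y → s :* x :+ t :* y :=
            x :* (𝟏 :- (s :- 𝟏) :- t) :+ ((𝟏 :+ 𝟏) :* x :* (s :- 𝟏) :+ ((x :+ y) :* t :+ 𝟘)))
              refl

        hull⊆span : ∀ {y} → AffineHull Wedge y → ∃[ s ] ∃[ t ] y ≋ span s t
        hull⊆span {y} (k , v , w , Wv , _ , y≋) =
          sum (λ i → s i * w i) , sum (λ i → t i * w i) , λ l → begin
            y l                                                  ≈⟨ y≋ l ⟩
            sum (λ i → v i l * w i)
              ≈⟨ sum-cong-≋ (λ i → trans (*-congʳ (proj₂ (proj₂ (proj₂ (Wv i))) l))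
                   (solve 5 (λ s t w x y →
                      (s :* x :+ t :* y) :* w := x :* (s :* w) :+ y :* (t :* w))
                      refl (s i) (t i) (w i) (ν l) (e l))) ⟩
            sum (λ i → ν l * (s i * w i) + e l * (t i * w i))
              ≈⟨ sum-⊕ (ν l ⊙ λ i → s i * w i) (e l ⊙ λ i → t i * w i) ⟩
            sum (ν l ⊙ λ i → s i * w i) + sum (e l ⊙ λ i → t i * w i)
              ≈⟨ +-cong (trans (sum-⊙ (ν l) (λ i → s i * w i)) (*-comm _ _))
                (trans (sum-⊙ (e l) (λ i → t i * w i)) (*-comm _ _)) ⟩
            sum (λ i → s i * w i) * ν l + sum (λ i → t i * w i) * e l  ∎
          where
          open SetoidReasoning setoid
          s t : ℝ^ k
          s i = proj₁ (proj₂ (Wv i))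
          t i = proj₁ (proj₂ (proj₂ (Wv i)))

        -- A point of the affine hull is s ν + t e. Its coordinates at b and j determine s and t, so
        -- a small enough box forces |t| ≤ s, which gives feasibility.
        wedge-interior : RelativeInterior Wedge ν
        wedge-interior = ν∈wedge , ε , *-pos 0<ej (proj₁ (proj₂ inv)) , near
          where
          D = 1# + ν j + e j
          inv = 0<inverse {D} (+-pos (+-pos 0<1 0≤νj) (proj₁ 0<ej))
          z = proj₁ inv
          ε = e j * z

          εD≈ej : ε * D ≈ e j
          εD≈ej = trans (solve 3 (λ m z D → m :* z :* D := m :* (D :* z)) refl (e j) z D)
            (trans (*-congˡ (proj₂ (proj₂ inv))) (*-identityʳ (e j)))

          near : ∀ y → AffineHull Wedge y → (∀ i → ν i - ε < y i × y i < ν i + ε) → Wedge y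
          near y hull box-y = Feasible-resp {span s t} {y} (≋-sym y≋)
            (span-feasible (proj₁ bounds) (proj₂ bounds)) , s , t , y≋
            where
            spanned = hull⊆span hull
            s       = proj₁ spanned
            t       = proj₁ (proj₂ spanned)
            y≋      = proj₂ (proj₂ spanned)

            open SetoidReasoning setoid

            y-b : y b ≈ ν b + (1# - s)
            y-b = begin
              y b                   ≈⟨ y≋ b ⟩
              s * ν b + t * e b     ≈⟨ +-cong (*-congˡ νb≈-1) (*-congˡ eb≈0) ⟩
              s * - 1# + t * 0#
                ≈⟨ solve 2 (λ s t → s :* :- 𝟏 :+ t :* 𝟘 := :- 𝟏 :+ (𝟏 :- s)) refl s t ⟩
              - 1# + (1# - s)       ≈⟨ +-congʳ νb≈-1 ⟨
              ν b + (1# - s)        ∎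

            y-j : y j ≈ ν j + ((s - 1#) * ν j + t * e j)
            y-j = trans (y≋ j)
              (solve 4 (λ s t x m → s :* x :+ t :* m := x :+ ((s :- 𝟏) :* x :+ t :* m))
              refl s t (ν j) (e j))

            at-b = box⁻ y-b (box-y b)
            at-j = box⁻ y-j (box-y j)

            bounds : 0# ≤ s + t × 0# ≤ s - t
            bounds = wedge-bounds 0<ej 0≤νj εD≈ej (proj₁ at-b) (proj₂ at-b) (proj₁ at-j)
              (proj₂ at-j)

      module _ (¬interior : ∀ (C : Pred (ℝ^ˢ A) (c ⊔ ℓ₁ ⊔ ℓ₂)) → IsConvexCone C →
                            HasDimension C 2 → C ⊆ Feasible → ¬ RelativeInterior C ν) where

        -- Division by M makes ν the midpoint of two feasible vectors ν + z d and ν - z d. If d had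
        -- a positive entry, their wedge would be a cone of the excluded kind; that entry is not at
        -- β because d vanishes there.
        no-scaled-direction : ∀ {d M} → Feasible (M ⊙ ν ⊕ d) → Feasible (M ⊙ ν ⊕ ⊖ d) →
                              d b ≈ 0# → ∀ {z} → 0# < z → M * z ≈ 1# → ∀ j → ¬ 0# < d j
        no-scaled-direction {d} {M} M+ M- db≈0 {z} 0<z Mz≈1 j 0<dj =
          ¬interior W.Wedge W.wedge-cone W.wedge-dimension proj₁ W.wedge-interior
          where
          open SetoidReasoning setoid

          A[j]≢β : ¬ A [ j ] ≋ β
          A[j]≢β e = 0<⇒≉0 0<dj (trans (reflexive (≡.cong d (unique j e))) db≈0)

          zM≈1 : ∀ x → z * (M * x) ≈ x
          zM≈1 x = begin
            z * (M * x)   ≈⟨ solve 3 (λ z M x → z :* (M :* x) := (M :* z) :* x) refl z M x ⟩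
            M * z * x     ≈⟨ *-congʳ Mz≈1 ⟩
            1# * x        ≈⟨ *-identityˡ x ⟩
            x             ∎

          ν+zd : Feasible (ν ⊕ z ⊙ d)
          ν+zd = Feasible-resp {z ⊙ (M ⊙ ν ⊕ d)} {ν ⊕ z ⊙ d}
            (λ i → trans (distribˡ z (M * ν i) (d i)) (+-congʳ (zM≈1 (ν i))))
            (Feasible-⊙ {z} {M ⊙ ν ⊕ d} (proj₁ 0<z) M+)

          ν-zd : Feasible (ν ⊕ ⊖ (z ⊙ d))
          ν-zd = Feasible-resp {z ⊙ (M ⊙ ν ⊕ ⊖ d)} {ν ⊕ ⊖ (z ⊙ d)}
            (λ i → trans (distribˡ z (M * ν i) (- d i))
              (+-cong (zM≈1 (ν i)) (sym (-‿distribʳ-* z (d i)))))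
            (Feasible-⊙ {z} {M ⊙ ν ⊕ ⊖ d} (proj₁ 0<z) M-)

          module W = Wedge {z ⊙ d} {j} ν+zd ν-zd
            (trans (*-congˡ db≈0) (zeroʳ z)) (*-pos 0<z 0<dj)
            (proj₁ (proj₁ feasible) j A[j]≢β)

        no-positive-direction : ∀ {d} → Flat A ν d → d b ≈ 0# → ∀ j → ¬ 0# < d j
        no-positive-direction {d} flat db≈0 =
          let M , 0<M , M+ , M- = Flat⇒segment {d} flat
              z , 0<z , Mz≈1 = 0<inverse 0<M
          in no-scaled-direction {d} {M} M+ M- db≈0 0<z Mz≈1

        ¬interior⇒Extreme : Extreme A ν
        ¬interior⇒Extreme μ flat = - μ b , λ i → vanishing i (trichotomy (d i))
          where
          -- As ν_b = -1, adding μ_b ν makes the entry at b vanish. Neither this direction nor its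
          -- negative has a positive entry, so it is zero and μ = -μ_b ν.
          d : ℝ^ˢ A
          d = μ ⊕ μ b ⊙ ν

          flat-d : Flat A ν d
          flat-d = Flat-⊕ {μ = μ} {μ b ⊙ ν} flat
            (Flat-⊙ (μ b) (Flat-self (proj₂ (proj₁ feasible))))

          db≈0 : d b ≈ 0#
          db≈0 = trans (+-congˡ (*-congˡ νb≈-1))
            (solve 1 (λ m → m :+ m :* :- 𝟏 := 𝟘) refl (μ b))

          vanishing : ∀ i → 0# < - d i ⊎ d i ≈ 0# ⊎ 0# < d i → μ i ≈ - μ b * ν i
          vanishing i (inj₁ 0<-d)         = contradiction 0<-d
            (no-positive-direction {⊖ d} (Flat-⊖ flat-d) (trans (-‿cong db≈0) -0#≈0#) i)
          vanishing i (inj₂ (inj₂ 0<d))   = contradiction 0<d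
            (no-positive-direction flat-d db≈0 i)
          vanishing i (inj₂ (inj₁ dᵢ≈0))  = begin
            μ i
              ≈⟨ solve 3 (λ m b n → m := (m :+ b :* n) :+ :- b :* n) refl (μ i) (μ b) (ν i) ⟩
            d i + - μ b * ν i                  ≈⟨ +-congʳ dᵢ≈0 ⟩
            0# + - μ b * ν i                   ≈⟨ +-identityˡ _ ⟩
            - μ b * ν i                        ∎
            where open SetoidReasoning setoid

  -- Projections

  ≋-trans : ∀ {k} {x y z : ℝ^ k} → x ≋ y → y ≋ z → x ≋ z
  ≋-trans x≋y y≋z i = trans (x≋y i) (y≋z i)

  embed : ∀ {n} (S : Subset n) → Fin ∣ S ∣ → Fin n
  embed (inside  ∷ S) zero    = zero
  embed (inside  ∷ S) (suc k) = suc (embed S k)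
  embed (outside ∷ S) k       = suc (embed S k)

  embed-∈ : ∀ {n} (S : Subset n) k → embed S k ∈ S
  embed-∈ (inside  ∷ S) zero    = here
  embed-∈ (inside  ∷ S) (suc k) = there (embed-∈ S k)
  embed-∈ (outside ∷ S) k       = there (embed-∈ S k)

  ∈⇒embed : ∀ {n} {S : Subset n} {i} → i ∈ S → ∃[ k ] embed S k ≡ i
  ∈⇒embed here = zero , ≡.refl
  ∈⇒embed {S = inside  ∷ S} (there i∈S) = let k , e = ∈⇒embed i∈S in suc k , ≡.cong suc e
  ∈⇒embed {S = outside ∷ S} (there i∈S) = let k , e = ∈⇒embed i∈S in k , ≡.cong suc e

  restrict-embed : ∀ {n} (S : Subset n) (x : ℝ^ n) k → restrict S x k ≡ x (embed S k)
  restrict-embed (inside  ∷ S) x zero    = ≡.refl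
  restrict-embed (inside  ∷ S) x (suc k) = restrict-embed S (Vector.tail x) k
  restrict-embed (outside ∷ S) x k       = restrict-embed S (Vector.tail x) k

  restrict-cong : ∀ {n} (S : Subset n) {x y : ℝ^ n} →
                  (∀ {i} → i ∈ S → x i ≈ y i) → restrict S x ≋ restrict S y
  restrict-cong S {x} {y} x≈y k = begin
    restrict S x k    ≡⟨ restrict-embed S x k ⟩
    x (embed S k)     ≈⟨ x≈y (embed-∈ S k) ⟩
    y (embed S k)     ≡⟨ restrict-embed S y k ⟨
    restrict S y k    ∎
    where open SetoidReasoning setoid

  restrict-injective : ∀ {n} (S : Subset n) {x y : ℝ^ n} →
                       restrict S x ≋ restrict S y → ∀ {i} → i ∈ S → x i ≈ y i
  restrict-injective S {x} {y} x≋y i∈S with ∈⇒embed i∈S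
  ... | k , ≡.refl = begin
    x (embed S k)     ≡⟨ restrict-embed S x k ⟨
    restrict S x k    ≈⟨ x≋y k ⟩
    restrict S y k    ≡⟨ restrict-embed S y k ⟩
    y (embed S k)     ∎
    where open SetoidReasoning setoid

  []-injective : ∀ {n} (A : SupportSet n) {i j} → A [ i ] ≋ A [ j ] → i ≡ j
  []-injective A {i} {j} = Unique⇒lookup-injective (≋-setoid _) (distinct A) i j

  module _ {n} (S : Subset n) (A : SupportSet n) where

    private
      B = project S A

      restrict∈B : ∀ i → restrict S (A [ i ]) ∈ˢ B
      restrict∈B i = Membership.∈-deduplicate⁺ (≋-setoid ∣ S ∣) _≋?_
        (λ y≋x z≋x → ≋-trans z≋x (≋-sym y≋x))
        (Any.map⁺ (Any.map (λ A[i]≋x → restrict-cong S λ {l} _ → A[i]≋x l)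
          (Membership.∈-lookup (≋-setoid n) (points A) i)))

    π : Fin (card A) → Fin (card B)
    π i = Any.index (restrict∈B i)

    π-restrict : ∀ i → restrict S (A [ i ]) ≋ B [ π i ]
    π-restrict i = Any.lookup-index (restrict∈B i)

    π-unique : ∀ {i j} → restrict S (A [ i ]) ≋ B [ j ] → π i ≡ j
    π-unique {i} {j} e = []-injective B {π i} {j} (≋-trans (≋-sym (π-restrict i)) e)

    -- The pushforward along `π`, adding up the entries over each fibre. Unlike `transport`, which
    -- searches for a preimage in the support of ν, it is linear and defined alike for all vectors;
    -- on ν the two agree when `π` is injective on the support.
    push : ℝ^ˢ A → ℝ^ˢ B
    push μ j = sum (λ i → μ i * δ (π i) j)

    push-cong : ∀ {μ μ′} → μ ≋ μ′ → push μ ≋ push μ′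
    push-cong μ≋μ′ j = sum-cong-≋ λ i → *-congʳ (μ≋μ′ i)

    push-⊙ : ∀ t μ → push (t ⊙ μ) ≋ t ⊙ push μ
    push-⊙ t μ j = trans (sum-cong-≋ λ i → *-assoc t (μ i) (δ (π i) j))
      (sum-⊙ t (λ i → μ i * δ (π i) j))

    -- The change of variables formula, by exchanging the two sums. A constant f gives the total
    -- mass, and a coordinate function of the points gives the weighted sum of the points.
    ·-push : ∀ (f : ℝ^ˢ B) μ → f · push μ ≈ (f ∘ π) · μ
    ·-push f μ = begin
      sum (λ j → f j * sum (λ i → μ i * δ (π i) j))
        ≈⟨ sum-cong-≋ (λ j → *-distribˡ-sum (f j) (λ i → μ i * δ (π i) j)) ⟩
      sum (λ j → sum (λ i → f j * (μ i * δ (π i) j)))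
        ≈⟨ ∑-comm (λ j i → f j * (μ i * δ (π i) j)) ⟩
      sum (λ i → sum (λ j → f j * (μ i * δ (π i) j)))
        ≈⟨ sum-cong-≋ (λ i → trans (sum-cong-≋ λ j → sym (*-assoc (f j) (μ i) (δ (π i) j)))
                                   (sum-δ (λ j → f j * μ i) (π i))) ⟩
      sum (λ i → f (π i) * μ i)  ∎
      where open SetoidReasoning setoid

    sum-push : ∀ μ → sum (push μ) ≈ sum μ
    sum-push μ = trans (sum-cong-≋ λ j → sym (*-identityˡ (push μ j)))
      (trans (·-push (λ _ → 1#) μ) (sum-cong-≋ λ i → *-identityˡ (μ i)))

    ∙-push : ∀ μ k → (B ∙ push μ) k ≈ (A ∙ μ) (embed S k)
    ∙-push μ k = trans (·-push (λ j → (B [ j ]) k) μ) (sum-cong-≋ λ i → *-congʳ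
      (trans (sym (π-restrict i k)) (reflexive (restrict-embed S (A [ i ]) k))))

    module _ (ν : ℝ^ˢ A) where

      InjectiveOnSupport : Set ℓ₁
      InjectiveOnSupport = ∀ {i i′} → ¬ ν i ≈ 0# → ¬ ν i′ ≈ 0# → π i ≡ π i′ → i ≡ i′

      preimage : ∀ j → (∃[ i ] ¬ ν i ≈ 0# × π i ≡ j) ⊎ (∀ i → ¬ ν i ≈ 0# → π i ≢ j)
      preimage j with any? (λ i → ¬? (ν i ≟ 0#) ×-dec (π i Fin.≟ j))
      ... | yes p = inj₁ p
      ... | no ¬p = inj₂ λ i νᵢ≉0 πi≡j → ¬p (i , νᵢ≉0 , πi≡j)

      push-outside : ∀ {μ} → (∀ i → ν i ≈ 0# → μ i ≈ 0#) →
                     ∀ {j} → (∀ i → ¬ ν i ≈ 0# → π i ≢ j) → push μ j ≈ 0#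
      push-outside {μ} support {j} away = sum-𝟎 (λ i → μ i * δ (π i) j) term
        where
        term : ∀ i → μ i * δ (π i) j ≈ 0#
        term i with ν i ≟ 0#
        ... | yes νᵢ≈0 = trans (*-congʳ (support i νᵢ≈0)) (zeroˡ (δ (π i) j))
        ... | no  νᵢ≉0 = trans (*-congˡ (reflexive (δ-≢ (away i νᵢ≉0)))) (zeroʳ (μ i))

      module _ (injective : InjectiveOnSupport) where

        -- In the fibre of `π i` every other point is outside the support, by injectivity, so the
        -- sum over the fibre has one term.
        push-π : ∀ {μ} → (∀ i → ν i ≈ 0# → μ i ≈ 0#) →
                 ∀ {i} → ¬ ν i ≈ 0# → push μ (π i) ≈ μ i
        push-π {μ} support {i} νᵢ≉0 = trans (sum-cong-≋ term) (sum-δ μ i)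
          where
          term : ∀ l → μ l * δ (π l) (π i) ≈ μ l * δ i l
          term l with ν l ≟ 0# | l Fin.≟ i
          ... | yes νₗ≈0 | _ = trans (*-congʳ (support l νₗ≈0)) (trans (zeroˡ (δ (π l) (π i)))
                  (sym (trans (*-congʳ (support l νₗ≈0)) (zeroˡ (δ i l)))))
          ... | no  νₗ≉0 | yes ≡.refl = *-congˡ
            (reflexive (≡.trans (δ-refl (π l)) (≡.sym (δ-refl l))))
          ... | no  νₗ≉0 | no l≢i     = *-congˡ (reflexive (≡.trans
                  (δ-≢ (l≢i ∘ injective νₗ≉0 νᵢ≉0)) (≡.sym (δ-≢ (l≢i ∘ ≡.sym)))))

        transport≋push : transport S A ν ≋ push ν
        transport≋push j with any?
          (λ i → ¬? (ν i ≟ 0#) ×-dec (restrict S (A [ i ]) ≋? (B [ j ])))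
        ... | yes (i , νᵢ≉0 , e) = trans (sym (push-π (λ _ e → e) νᵢ≉0))
                (reflexive (≡.cong (push ν) (π-unique {i} {j} e)))
        ... | no ¬p = sym (push-outside (λ _ e → e)
                λ { i νᵢ≉0 ≡.refl → ¬p (i , νᵢ≉0 , π-restrict i) })

        private
          τ = transport S A ν

        transport-π : ∀ {i} → ¬ ν i ≈ 0# → τ (π i) ≈ ν i
        transport-π {i} νᵢ≉0 = trans (transport≋push (π i)) (push-π (λ _ e → e) νᵢ≉0)

        transport-outside : ∀ {j} → (∀ i → ¬ ν i ≈ 0# → π i ≢ j) → τ j ≈ 0#
        transport-outside {j} away = trans (transport≋push j) (push-outside (λ _ e → e) away)

        ∙-transport : ∀ k → (B ∙ τ) k ≈ (A ∙ ν) (embed S k)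
        ∙-transport k = trans (combination-cong (B [_]) transport≋push k) (∙-push ν k)

        -- Points outside the support of ν may share a projection with points inside it. Setting
        -- their entries to 0 leaves one preimage per fibre, so that `push` undoes `pull` on vectors
        -- vanishing where `τ` does.
        pull : ℝ^ˢ B → ℝ^ˢ A
        pull μ i with ν i ≟ 0#
        ... | yes _ = 0#
        ... | no  _ = μ (π i)

        pull-support : ∀ μ i → ν i ≈ 0# → pull μ i ≈ 0#
        pull-support μ i νᵢ≈0 with ν i ≟ 0#
        ... | yes _    = refl
        ... | no  νᵢ≉0 = contradiction νᵢ≈0 νᵢ≉0

        pull-π : ∀ μ {i} → ¬ ν i ≈ 0# → pull μ i ≈ μ (π i)
        pull-π μ {i} νᵢ≉0 with ν i ≟ 0#
        ... | yes νᵢ≈0 = contradiction νᵢ≈0 νᵢ≉0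
        ... | no  _    = refl

        push-pull : ∀ {μ} → (∀ j → τ j ≈ 0# → μ j ≈ 0#) → push (pull μ) ≋ μ
        push-pull {μ} support j with preimage j
        ... | inj₁ (i , νᵢ≉0 , ≡.refl) = trans (push-π (pull-support μ) νᵢ≉0) (pull-π μ νᵢ≉0)
        ... | inj₂ away = trans (push-outside (pull-support μ) away)
                (sym (support j (transport-outside away)))

        -- A flat direction on the projected side is pulled back. The projection sees only the
        -- coordinates in S, so flatness upstairs needs every zero of Aν to lie in S; that Aν
        -- vanishes on S makes all of them active downstairs.
        transport-Extreme : (∀ {l} → l ∈ S → (A ∙ ν) l ≈ 0#) →
                            (∀ {l} → (A ∙ ν) l ≈ 0# → l ∈ S) →
                            Extreme A ν → Extreme B τ
        transport-Extreme zero-on-S S-zero extreme μ flat =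
          let t , pull≋ = extreme (pull μ) pull-flat in
          t , λ j → begin
            μ j                     ≈⟨ push-pull F.support j ⟨
            push (pull μ) j         ≈⟨ push-cong pull≋ j ⟩
            push (t ⊙ ν) j          ≈⟨ push-⊙ t ν j ⟩
            t * push ν j            ≈⟨ *-congˡ (transport≋push j) ⟨
            t * τ j                 ∎
          where
          open SetoidReasoning setoid
          module F = Flat flat

          ∙-pull : ∀ k → (A ∙ pull μ) (embed S k) ≈ 0#
          ∙-pull k = begin
            (A ∙ pull μ) (embed S k)  ≈⟨ ∙-push (pull μ) k ⟨
            (B ∙ push (pull μ)) k     ≈⟨ combination-cong (B [_]) (push-pull F.support) k ⟩
            (B ∙ μ) k
              ≈⟨ F.kernel k (trans (∙-transport k) (zero-on-S (embed-∈ S k))) ⟩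
            0#                        ∎

          pull-flat : Flat A ν (pull μ)
          pull-flat = record
            { support  = pull-support μ
            ; balanced = trans (sym (sum-push (pull μ)))
                (trans (sum-cong-≋ (push-pull F.support)) F.balanced)
            ; kernel   = λ l Aνₗ≈0 → let k , e = ∈⇒embed (S-zero Aνₗ≈0) in
                trans (reflexive (≡.cong (A ∙ pull μ) (≡.sym e))) (∙-pull k)
            }

        -- A flat direction is pushed forward; it lies in the kernel because Aν vanishes at every
        -- coordinate of S. The resulting multiple is read off on the support of ν, and off the
        -- support both sides are 0.
        transport-Extreme⁻ : (∀ {l} → l ∈ S → (A ∙ ν) l ≈ 0#) → Extreme B τ → Extreme A ν
        transport-Extreme⁻ zero-on-S extreme μ flat =
          let t , push≋ = extreme (push μ) push-flat in
          t , λ i → multiple t push≋ i (ν i ≟ 0#)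
          where
          open SetoidReasoning setoid
          module F = Flat flat

          push-flat : Flat B τ (push μ)
          push-flat = record
            { support  = λ j τⱼ≈0 → push-outside F.support λ { i νᵢ≉0 ≡.refl →
                νᵢ≉0 (trans (sym (transport-π νᵢ≉0)) τⱼ≈0) }
            ; balanced = trans (sum-push μ) F.balanced
            ; kernel   = λ k _ → trans (∙-push μ k)
                (F.kernel (embed S k) (zero-on-S (embed-∈ S k)))
            }

          multiple : ∀ t → push μ ≋ t ⊙ τ → ∀ i → Dec (ν i ≈ 0#) → μ i ≈ t * ν i
          multiple t push≋ i (yes νᵢ≈0) = trans (F.support i νᵢ≈0)
            (sym (trans (*-congˡ νᵢ≈0) (zeroʳ t)))
          multiple t push≋ i (no νᵢ≉0) = begin
            μ i              ≈⟨ push-π F.support νᵢ≉0 ⟨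
            push μ (π i)     ≈⟨ push≋ (π i) ⟩
            t * τ (π i)      ≈⟨ *-congˡ (transport-π νᵢ≉0) ⟩
            t * ν i          ∎

      ∈supp⁺ : ∀ {i} → ¬ ν i ≈ 0# → i Propositional.∈ supp A ν
      ∈supp⁺ {i} νᵢ≉0 =
        Propositional.∈-filter⁺ (λ i → ¬? (ν i ≟ 0#)) (Propositional.∈-allFin i) νᵢ≉0

      ∈supp⁻ : ∀ {i} → i Propositional.∈ supp A ν → ¬ ν i ≈ 0#
      ∈supp⁻ i∈ = proj₂
        (Propositional.∈-filter⁻ (λ i → ¬? (ν i ≟ 0#)) {xs = allFin (card A)} i∈)

      length⇒injective : length (projectedSupp S A ν) ≡ length (supp A ν) → InjectiveOnSupport
      length⇒injective e {i} {i′} νᵢ≉0 νᵢ′≉0 πi≡πi′ = deduplicate-map⇒injective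
        (≋-decSetoid ∣ S ∣)
        (λ i → restrict S (A [ i ])) e (∈supp⁺ νᵢ≉0) (∈supp⁺ νᵢ′≉0)
        (≋-trans (π-restrict i) (≋-trans (λ k → reflexive (≡.cong (λ j → (B [ j ]) k) πi≡πi′))
          (≋-sym (π-restrict i′))))

      injective⇒length : InjectiveOnSupport → length (projectedSupp S A ν) ≡ length (supp A ν)
      injective⇒length injective = injective⇒deduplicate-map (≋-decSetoid ∣ S ∣)
        (λ i → restrict S (A [ i ]))
          (Unique.filter⁺ (λ i → ¬? (ν i ≟ 0#)) (Unique.allFin⁺ (card A)))
        λ {i} {i′} i∈ i′∈ e → injective (∈supp⁻ i∈) (∈supp⁻ i′∈)
          (π-unique {i} (≋-trans e (π-restrict i′)))

  -- Circuits of the orthant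

  module _ {n p} {X : Pred (ℝ^ n) p} {P : Pred ℝ ℓ₂} (polar : HasPolar X P)
           {A : SupportSet n} {β : ℝ^ n} {ν : ℝ^ˢ A} {b : Fin (card A)}
           (unique : ∀ i → A [ i ] ≋ β → i ≡ b) (νb≈-1 : ν b ≈ - 1#) where

    open HasPolar polar
    open Feasibility isSignCondition A β

    circuit⇒feasible : IsCircuit X A β ν → Feasible ν
    circuit⇒feasible circuit = ν∈N , finite⇒sign (proj₂ finite)
      where open IsCircuit circuit

    -- On any cone inside K the support function is the zero function, which is linear; so condition
    -- (ii) excludes every two-dimensional cone in K, whatever its shape.
    circuit⇒extreme : IsCircuit X A β ν → Extreme A ν
    circuit⇒extreme circuit = ¬interior⇒Extreme {ν} {b} unique νb≈-1 (circuit⇒feasible circuit)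
      λ C cone dimension C⊆ → extremal C cone dimension (λ Cμ → proj₁ (C⊆ Cμ)) (linear C C⊆)
      where
      open IsCircuit circuit

      zero-linear : IsLinear {card A} (λ _ → 0#)
      zero-linear = record
        { cong   = λ _ → refl
        ; ⊕-homo = λ _ _ → sym (+-identityˡ 0#)
        ; ⊙-homo = λ t _ → sym (zeroʳ t)
        }

      linear : ∀ C → C ⊆ Feasible → LinearOn X A C
      linear C C⊆ = (λ _ → 0#) , zero-linear , λ {μ} Cμ → sign⇒σ≈0 (proj₂ (C⊆ Cμ))

    feasible∧extreme⇒circuit : Feasible ν → Extreme A ν → IsCircuit X A β ν
    feasible∧extreme⇒circuit feasible extreme = record
      { ν∈N      = proj₁ feasible
      ; nonZero  = λ ν≋𝟎 → -1≉0 (trans (sym νb≈-1) (ν≋𝟎 b))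
      ; finite   = 0# , sign⇒σ≈0 (proj₂ feasible)
      -- Agreeing with a linear function includes being finite, and finiteness puts all of C inside
      -- K.
      ; extremal = λ C _ dimension C⊆N (f , _ , σ≈f) →
          Extreme⇒¬interior {ν} {b} unique νb≈-1 feasible extreme C
            (λ {μ} Cμ → C⊆N Cμ , finite⇒sign (σ≈f Cμ)) dimension
      }

  positive-pair : ∀ {n} (A : SupportSet n) (ν : ℝ^ˢ A) → 2 ℕ.≤ length (supp⁺ A ν) →
                  ∃[ p ] ∃[ q ] p ≢ q × 0# < ν p × 0# < ν q
  positive-pair A ν 2≤ = extract (supp⁺ A ν) 2≤
    (Unique.filter⁺ (λ i → 0# <? ν i) (Unique.allFin⁺ (card A)))
    λ i∈ → proj₂ (Propositional.∈-filter⁻ (λ i → 0# <? ν i) {xs = allFin (card A)} i∈)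
    where
    extract : ∀ is → 2 ℕ.≤ length is → Propositional.Unique is →
              (∀ {i} → i Propositional.∈ is → 0# < ν i) →
              ∃[ p ] ∃[ q ] p ≢ q × 0# < ν p × 0# < ν q
    extract (p ∷ q ∷ _) _ ((p≢q ∷ _) ∷ _) pos =
      p , q , p≢q , pos (here ≡.refl) , pos (there (here ≡.refl))
    extract (_ ∷ []) (ℕ.s≤s ()) _ _

  pigeonhole : ∀ {a} {I : Set a} {p q r x y : I} → p ≢ q → p ≢ r → q ≢ r →
               p ≡ x ⊎ p ≡ y → q ≡ x ⊎ q ≡ y → r ≡ x ⊎ r ≡ y → ⊥
  pigeonhole p≢q p≢r q≢r (inj₁ ≡.refl) (inj₁ ≡.refl) _             = p≢q ≡.refl
  pigeonhole p≢q p≢r q≢r (inj₂ ≡.refl) (inj₂ ≡.refl) _             = p≢q ≡.refl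
  pigeonhole p≢q p≢r q≢r (inj₁ ≡.refl) (inj₂ ≡.refl) (inj₁ ≡.refl) = p≢r ≡.refl
  pigeonhole p≢q p≢r q≢r (inj₁ ≡.refl) (inj₂ ≡.refl) (inj₂ ≡.refl) = q≢r ≡.refl
  pigeonhole p≢q p≢r q≢r (inj₂ ≡.refl) (inj₁ ≡.refl) (inj₁ ≡.refl) = q≢r ≡.refl
  pigeonhole p≢q p≢r q≢r (inj₂ ≡.refl) (inj₁ ≡.refl) (inj₂ ≡.refl) = p≢r ≡.refl

  sum-of-δ : ∀ {k} (i : Fin k) → sum (δ i) ≈ 1#
  sum-of-δ i = trans (sum-cong-≋ λ j → sym (*-identityˡ (δ i j))) (sum-δ (λ _ → 1#) i)

  module _ {n} (A : SupportSet n) (ν : ℝ^ˢ A) {b p q : Fin (card A)}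
           (νb≈-1 : ν b ≈ - 1#) (p≢q : p ≢ q) (0<νp : 0# < ν p) (0<νq : 0# < ν q) where

    private
      b≢ : ∀ {i} → 0# < ν i → i ≢ b
      b≢ 0<νi ≡.refl = 0<⇒¬≤0 0<νi (≤-respˡ-≈ (sym νb≈-1)
        (0≤-⇒≤0 (0≤-resp (sym (-‿involutive 1#)) (proj₁ 0<1))))

    -- Otherwise the difference of the two unit vectors is a flat direction,
    -- hence a multiple of ν, whose support contains p, q and b.
    extreme⇒separated : Extreme A ν → ∀ {i i′} → ¬ ν i ≈ 0# → ¬ ν i′ ≈ 0# →
      (∀ {l} → (A ∙ ν) l ≈ 0# → (A [ i ]) l ≈ (A [ i′ ]) l) → i ≡ i′
    extreme⇒separated extreme {i} {i′} νᵢ≉0 νᵢ′≉0 agree = decidable-stable (i Fin.≟ i′) λ i≢i′ →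
      let t , μ≋tν = extreme μ flat in
      absurd t μ≋tν i≢i′
      where
      open SetoidReasoning setoid

      μ : ℝ^ˢ A
      μ = δ i ⊕ ⊖ δ i′

      μ-outside : ∀ {l} → i ≢ l → i′ ≢ l → μ l ≈ 0#
      μ-outside i≢l i′≢l = trans
        (+-cong (reflexive (δ-≢ i≢l)) (-‿cong (reflexive (δ-≢ i′≢l)))) (-‿inverseʳ 0#)

      flat : Flat A ν μ
      flat = record
        { support  = λ l νₗ≈0 → μ-outside (λ { ≡.refl → νᵢ≉0 νₗ≈0 }) (λ { ≡.refl → νᵢ′≉0 νₗ≈0 })
        ; balanced = begin
            sum (δ i ⊕ ⊖ δ i′)              ≈⟨ sum-⊕ (δ i) (⊖ δ i′) ⟩
            sum (δ i) + sum (⊖ δ i′)        ≈⟨ +-cong (sum-of-δ i) (sum-⊖ (δ i′)) ⟩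
            1# + - sum (δ i′)               ≈⟨ +-congˡ (-‿cong (sum-of-δ i′)) ⟩
            1# - 1#                         ≈⟨ -‿inverseʳ 1# ⟩
            0#                              ∎
        ; kernel   = λ l Aνₗ≈0 → begin
            (A ∙ (δ i ⊕ ⊖ δ i′)) l          ≈⟨ combination-⊕ (A [_]) (δ i) (⊖ δ i′) l ⟩
            (A ∙ δ i) l + (A ∙ (⊖ δ i′)) l  ≈⟨ +-congˡ (combination-⊖ (A [_]) (δ i′) l) ⟩
            (A ∙ δ i) l - (A ∙ δ i′) l
              ≈⟨ +-cong (sum-δ (λ j → (A [ j ]) l) i) (-‿cong (sum-δ (λ j → (A [ j ]) l) i′)) ⟩
            (A [ i ]) l - (A [ i′ ]) l      ≈⟨ +-congʳ (agree Aνₗ≈0) ⟩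
            (A [ i′ ]) l - (A [ i′ ]) l     ≈⟨ -‿inverseʳ _ ⟩
            0#                              ∎
        }

      absurd : ∀ t → μ ≋ t ⊙ ν → i ≢ i′ → ⊥
      -- With t non-zero, the support of ν lies within that of μ, so p, q and b would be three
      -- distinct elements of a set of two.
      absurd t μ≋tν i≢i′ = pigeonhole p≢q (b≢ 0<νp) (b≢ 0<νq)
        (located (0<⇒≉0 0<νp)) (located (0<⇒≉0 0<νq))
          (located λ νb≈0 → -1≉0 (trans (sym νb≈-1) νb≈0))
        where
        t≉0 : ¬ t ≈ 0#
        t≉0 t≈0 = 0≉1 (begin
          0#                ≈⟨ zeroˡ (ν i) ⟨
          0# * ν i          ≈⟨ *-congʳ t≈0 ⟨
          t * ν i           ≈⟨ μ≋tν i ⟨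
          δ i i - δ i′ i
            ≈⟨ +-cong (reflexive (δ-refl i)) (-‿cong (reflexive (δ-≢ (i≢i′ ∘ ≡.sym)))) ⟩
          1# - 0#           ≈⟨ trans (+-congˡ -0#≈0#) (+-identityʳ 1#) ⟩
          1#                ∎)

        located : ∀ {l} → ¬ ν l ≈ 0# → l ≡ i ⊎ l ≡ i′
        located {l} νₗ≉0 with l Fin.≟ i | l Fin.≟ i′
        ... | yes l≡i | _        = inj₁ l≡i
        ... | no  _   | yes l≡i′ = inj₂ l≡i′
        ... | no  l≢i | no  l≢i′ = contradiction
          (*-cancel-0 t≉0 (trans (sym (μ≋tν l)) (μ-outside (l≢i ∘ ≡.sym) (l≢i′ ∘ ≡.sym)))) νₗ≉0

  -- The active coordinates and the two implications

  zeroSet : ∀ {n} → ℝ^ n → Subset n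
  zeroSet x = Vec.tabulate λ i → does (x i ≟ 0#)

  ∈zeroSet⁺ : ∀ {n} (x : ℝ^ n) {i} → x i ≈ 0# → i ∈ zeroSet x
  ∈zeroSet⁺ x {i} xᵢ≈0 = lookup⇒[]= i (zeroSet x)
    (≡.trans (lookup∘tabulate (λ i → does (x i ≟ 0#)) i) (dec-true (x i ≟ 0#) xᵢ≈0))

  ∈zeroSet⁻ : ∀ {n} (x : ℝ^ n) {i} → i ∈ zeroSet x → x i ≈ 0#
  ∈zeroSet⁻ x {i} i∈ = decidable-stable (x i ≟ 0#) λ xᵢ≉0 → contradiction
    (≡.trans (≡.sym ([]=⇒lookup i∈))
      (≡.trans (lookup∘tabulate (λ i → does (x i ≟ 0#)) i) (dec-false (x i ≟ 0#) xᵢ≉0)))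
    λ ()

  module Equivalence {n} (A : SupportSet n) (β : ℝ^ n) (β∈A : β ∈ˢ A) (ν : ℝ^ˢ A)
                     (ν∈N : N A β ν) (νb≈-1 : coord A ν β∈A ≈ - 1#) where

    b : Fin (card A)
    b = Any.index β∈A

    β≋A[b] : β ≋ A [ b ]
    β≋A[b] = Any.lookup-index β∈A

    unique : ∀ i → A [ i ] ≋ β → i ≡ b
    unique i A[i]≋β = []-injective A {i} {b} (≋-trans A[i]≋β β≋A[b])

    νb≉0 : ¬ ν b ≈ 0#
    νb≉0 νb≈0 = -1≉0 (trans (sym νb≈-1) νb≈0)

    module _ (S : Subset n) where

      unique-π : ∀ j → project S A [ j ] ≋ restrict S β → j ≡ π S A b
      unique-π j e = ≡.sym (π-unique S A {b} {j}
        (≋-trans (restrict-cong S λ {l} _ → sym (β≋A[b] l)) (≋-sym e)))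

      module _ (injective : InjectiveOnSupport S A ν) where

        transport-b : transport S A ν (π S A b) ≈ - 1#
        transport-b = trans (transport-π S A ν injective νb≉0) νb≈-1

        transport∈N : N (project S A) (restrict S β) (transport S A ν)
        transport∈N = nonNegative ,
          trans (sum-cong-≋ (transport≋push S A ν injective))
            (trans (sum-push S A ν) (proj₂ ν∈N))
          where
          nonNegative : ∀ j → ¬ project S A [ j ] ≋ restrict S β → 0# ≤ transport S A ν j
          nonNegative j ≢β with preimage S A ν j
          ... | inj₂ away = ≤-reflexive (sym (transport-outside S A ν injective away))
          ... | inj₁ (i , νᵢ≉0 , ≡.refl) = 0≤-resp (sym (transport-π S A ν injective νᵢ≉0))
            (proj₁ ν∈N i λ A[i]≋β → ≢β (≋-trans (≋-sym (π-restrict S A i))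
              (restrict-cong S λ {l} _ → A[i]≋β l)))

    Condition : Subset n → Set _
    Condition S = Nonempty S × length (projectedSupp S A ν) ≡ length (supp A ν) ×
                  IsCircuit U (project S A) (restrict S β) (transport S A ν) ×
                  (∀ i → i ∉ S → 0# < (A ∙ ν) i)

    orthant-circuit⇒ : 2 ℕ.≤ length (supp⁺ A ν) → IsCircuit Orthant A β ν → ∃[ S ] Condition S
    orthant-circuit⇒ 2≤ circuit = S , nonempty , injective⇒length S A ν injective ,
      feasible∧extreme⇒circuit U-polar (unique-π S) (transport-b S injective)
        (transport∈N S injective , λ k → ≈0⇒Null
          (trans (∙-transport S A ν injective k) (zero-on-S (embed-∈ S k))))
        (transport-Extreme S A ν injective zero-on-S (∈zeroSet⁺ (A ∙ ν)) extreme) ,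
      λ i i∉S → proj₂ feasible i , λ 0≈Aνᵢ → i∉S (∈zeroSet⁺ (A ∙ ν) (sym 0≈Aνᵢ))
      where
      S = zeroSet (A ∙ ν)
      feasible = circuit⇒feasible orthant-polar unique νb≈-1 circuit
      extreme  = circuit⇒extreme orthant-polar unique νb≈-1 circuit

      zero-on-S : ∀ {l} → l ∈ S → (A ∙ ν) l ≈ 0#
      zero-on-S = ∈zeroSet⁻ (A ∙ ν)

      pair = positive-pair A ν 2≤
      p = proj₁ pair
      q = proj₁ (proj₂ pair)
      p≢q = proj₁ (proj₂ (proj₂ pair))
      0<νp = proj₁ (proj₂ (proj₂ (proj₂ pair)))
      0<νq = proj₂ (proj₂ (proj₂ (proj₂ pair)))

      separated = extreme⇒separated A ν νb≈-1 p≢q 0<νp 0<νq extreme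

      injective : InjectiveOnSupport S A ν
      injective {i} {i′} νᵢ≉0 νᵢ′≉0 πi≡πi′ = separated νᵢ≉0 νᵢ′≉0 λ Aνₗ≈0 →
        restrict-injective S (≋-trans (π-restrict S A i)
          (≋-trans (λ k → reflexive (≡.cong (λ j → (project S A [ j ]) k) πi≡πi′))
            (≋-sym (π-restrict S A i′))))
          (∈zeroSet⁺ (A ∙ ν) Aνₗ≈0)

      nonempty : Nonempty S
      -- If no coordinate of Aν vanished, p and q would agree vacuously on the active coordinates
      -- and could not be distinct.
      nonempty = decidable-stable (nonempty? S) λ empty → p≢q
        (separated (0<⇒≉0 0<νp) (0<⇒≉0 0<νq) λ {l} Aνₗ≈0 → contradiction
          (l , ∈zeroSet⁺ (A ∙ ν) Aνₗ≈0) empty)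

    -- A circuit of the whole space satisfies the sign condition of the whole space, so Aν is 0 on
    -- S; with positivity off S this makes ν feasible for the orthant, and extremality is carried
    -- back along the projection.
    orthant-circuit⇐ : ∃[ S ] Condition S → IsCircuit Orthant A β ν
    orthant-circuit⇐ (S , _ , same , circuit , positive) =
      feasible∧extreme⇒circuit orthant-polar unique νb≈-1 (ν∈N , nonNegative)
        (transport-Extreme⁻ S A ν injective zero-on-S
          (circuit⇒extreme U-polar (unique-π S) (transport-b S injective) circuit))
      where
      injective : InjectiveOnSupport S A ν
      injective = length⇒injective S A ν same

      zero-on-S : ∀ {l} → l ∈ S → (A ∙ ν) l ≈ 0#
      zero-on-S l∈S with ∈⇒embed l∈S
      ... | k , ≡.refl = trans (sym (∙-transport S A ν injective k))
        (Null⇒≈0 (proj₂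
          (circuit⇒feasible U-polar (unique-π S) (transport-b S injective) circuit) k))

      nonNegative : ∀ l → 0# ≤ (A ∙ ν) l
      nonNegative l with l ∈? S
      ... | yes l∈S = ≤-reflexive (sym (zero-on-S l∈S))
      ... | no  l∉S = proj₁ (positive l l∉S)

theorem4p5 : ∀ {c ℓ₁ ℓ₂} (R : Reals c ℓ₁ ℓ₂) →
  let open Reals R
      open Circuits R
  in
  ∀ (n : ℕ) → 2 ℕ.≤ n →
  ∀ (A : SupportSet n) (β : ℝ^ n) (β∈A : β ∈ˢ A) (ν : ℝ^ˢ A) →
  N A β ν → coord A ν β∈A ≈ - 1# → 2 ℕ.≤ length (supp⁺ A ν) →
  Λ Orthant A β∈A ν ⇔
  (∃[ S ] Nonempty {n} S ×
          length (projectedSupp S A ν) ≡ length (supp A ν) ×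
          IsCircuit U (project S A) (restrict S β) (transport S A ν) ×
          (∀ i → i ∉ S → 0# < (A ∙ ν) i))
theorem4p5 R n _ A β β∈A ν ν∈N νb≈-1 2≤ = mk⇔
  (λ (circuit , _) → orthant-circuit⇒ 2≤ circuit)
  (λ condition → orthant-circuit⇐ condition , νb≈-1)
  where open Equivalence R A β β∈A ν ν∈N νb≈-1
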